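{- There is a polynomial $p$ such that for every $n\ge 2$ and every choice of guard functions $r,s$ (as in the context), the guarded graph tautology formula $\mathrm{GGT}_n$ has a tree-like regular resolution refutation with input lemmas (a regRTI refutation) with at most $p(n)$ clauses.
   Context: Clauses are sets of literals (disjunctions); a resolution inference derives $A'\lor B'$ from $A'\lor x$ and $B'\lor \overline{x}$ (with $\overline x\notin A'$, $x\notin B'$), resolving on $x$. A pool resolution (regRTL) refutation of a set $F$ of clauses is a finite binary tree $T$ of clauses such that: the root is the empty clause; each internal node is obtained by resolution from its two children; each leaf is either a clause of $F$ or a clause ("lemma") labeling a node occurring earlier in the postorder of $T$ (postorder: for a node $u$, every node $v$ in the left subtree and every node $w$ in the right subtree satisfy $v<w<u$); and along every root-to-leaf path each variable is resolved on at most once. A regRTI refutation is a pool resolution refutation in which every lemma used at a leaf is an input lemma: it is the conclusion of an earlier subderivation of $T$ that is an input derivation, i.e. each inference in that subderivation has at least one hypothesis that is a member of $F$ or a lemma. Graph tautology variables: for $[n]=\{0,\dots,n-1\}$ there are variables $x_{i,j}$ for $i<j$, and for $i>j$, $x_{i,j}$ denotes $\overline x_{j,i}$. For distinct $i,j,k$, $T_{i,j,k}:=\overline x_{i,j}\lor\overline x_{j,k}\lor\overline x_{k,i}$. Let $r,s:[n]^3\to[n]$ satisfy, for distinct $i,j,k$: $r(i,j,k)\ne s(i,j,k)$, $\{r(i,j,k),s(i,j,k)\}\not\subseteq\{i,j,k\}$, and invariance under cyclic rotation of $(i,j,k)$. $\mathrm{GGT}_n$ consists of the clauses $\bigvee_{j\ne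 i}x_{j,i}$ for each $i\in[n]$, and for all distinct $i,j,k$ (with $r=r(i,j,k)$, $s=s(i,j,k)$) the clauses $T_{i,j,k}\lor x_{r,s}$ and $T_{i,j,k}\lor \overline x_{r,s}$. -}

module Defs where

open import Data.Nat using (ℕ; zero; suc; _+_; _*_; _≤_)
open import Data.Bool using (Bool; true; false; _∧_; _∨_; if_then_else_; not)
open import Data.Fin using (Fin; _<?_; _≟_)
open import Data.List using (List; []; _∷_; _++_; map; filter; allFin)
open import Data.List.Membership.Propositional using (_∈_; _∉_)
open import Data.Product using (Σ; Σ-syntax; _×_; _,_)
open import Data.Sum using (_⊎_)
open import Function.Bundles using (_⇔_)
open import Relation.Nullary using (¬_; yes; no; ¬?)

open import Relation.Binary.PropositionalEquality using (_≡_; _≢_)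

Lit : Set → Set
Lit V = V × Bool

pos neg : {V : Set} → V → Lit V
pos v = v , true
neg v = v , false

compl : {V : Set} → Lit V → Lit V
compl (v , b) = v , not b

-- Clauses are sets of literals, represented by lists up to set equality.
Clause : Set → Set
Clause V = List (Lit V)

_≐_ : {V : Set} → Clause V → Clause V → Set
C ≐ D = ∀ l → (l ∈ C) ⇔ (l ∈ D)

-- Res v C₁ C₂ C : C = A' ∨ B' is derived from C₁ = A' ∨ x and C₂ = B' ∨ x̄
-- (x = pos v), with x ∉ A', x̄ ∉ A', x ∉ B', x̄ ∉ B'.
Res : {V : Set} → V → Clause V → Clause V → Clause V → Set
Res v C₁ C₂ C =
  (pos v ∈ C₁) × (neg v ∈ C₂) × (neg v ∉ C₁) × (pos v ∉ C₂) ×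
  (∀ l → (l ∈ C) ⇔ (((l ∈ C₁) × (l ≢ pos v)) ⊎ ((l ∈ C₂) × (l ≢ neg v))))

-- Binary trees of clauses; internal nodes record the resolved variable.
data Tree (V : Set) : Set where
  leaf : Clause V → Tree V
  node : Clause V → V → Tree V → Tree V → Tree V

label : {V : Set} → Tree V → Clause V
label (leaf C) = C
label (node C _ _ _) = C

size : {V : Set} → Tree V → ℕ
size (leaf _) = 1
size (node _ _ L R) = suc (size L + size R)

isLeaf : {V : Set} → Tree V → Bool
isLeaf (leaf _) = true
isLeaf (node _ _ _ _) = false

-- input derivation: every inference has at least one hypothesis that is a
-- leaf (i.e. a member of F or a lemma)
isInput : {V : Set} → Tree V → Bool
isInput (leaf _) = true
isInput (node _ _ L R) = (isLeaf L ∨ isLeaf R) ∧ (isInput L ∧ isInput R)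

-- In postorder, the conclusions of those nodes whose subderivation is an
-- input derivation (the clauses usable as input lemmas later on).
inputConcls : {V : Set} → Tree V → List (Clause V)
inputConcls (leaf C) = C ∷ []
inputConcls (node C v L R) =
  inputConcls L ++ inputConcls R ++
  (if isInput (node C v L R) then C ∷ [] else [])

-- Valid F anc avail T : T is a correct regRTI subderivation from the set of
-- clauses F (given as a predicate), where anc = variables resolved on the
-- path from the root to T, and avail = input lemmas occurring before T in
-- postorder.
Valid : {V : Set} → (Clause V → Set) → List V → List (Clause V) → Tree V → Set
Valid F anc avail (leaf C) =
  (Σ[ D ∈ Clause _ ] (F D × C ≐ D)) ⊎ (Σ[ D ∈ Clause _ ] (D ∈ avail × C ≐ D))
Valid F anc avail (node C v L R) =
  (v ∉ anc) ×
  (Res v (label L) (label R) C ⊎ Res v (label R) (label L) C) ×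
  Valid F (v ∷ anc) avail L ×
  Valid F (v ∷ anc) (avail ++ inputConcls L) R

RegRTIRefutation : {V : Set} → (Clause V → Set) → Tree V → Set
RegRTIRefutation F T = Valid F [] [] T × (label T ≐ [])

evalPoly : List ℕ → ℕ → ℕ
evalPoly [] x = 0
evalPoly (a ∷ as) x = a + x * evalPoly as x

-- Var n: the pair (i , j) stands for x_{i,j}; only pairs with i < j are used.
Var : ℕ → Set
Var n = Fin n × Fin n

-- the literal x_{i,j} (for i > j it is the negation of x_{j,i});
-- only meaningful for i ≢ j.
x : {n : ℕ} → Fin n → Fin n → Lit (Var n)
x i j with i <? j
... | yes _ = pos (i , j)
... | no _ = neg (j , i)

wideClause : {n : ℕ} → Fin n → Clause (Var n)
wideClause {n} i = map (λ j → x j i) (filter (λ j → ¬? (j ≟ i)) (allFin n))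

triClause : {n : ℕ} → Fin n → Fin n → Fin n → Lit (Var n) → Clause (Var n)
triClause i j k ℓ = compl (x i j) ∷ compl (x j k) ∷ compl (x k i) ∷ ℓ ∷ []

Distinct3 : {n : ℕ} → Fin n → Fin n → Fin n → Set
Distinct3 i j k = (i ≢ j) × (j ≢ k) × (k ≢ i)

In3 : {n : ℕ} → Fin n → Fin n → Fin n → Fin n → Set
In3 a i j k = (a ≡ i) ⊎ (a ≡ j) ⊎ (a ≡ k)

Guards : {n : ℕ} → (r s : Fin n → Fin n → Fin n → Fin n) → Set
Guards r s = ∀ i j k → Distinct3 i j k →
  (r i j k ≢ s i j k) ×
  ¬ (In3 (r i j k) i j k × In3 (s i j k) i j k) ×
  (r i j k ≡ r j k i) × (s i j k ≡ s j k i)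

data GGT {n : ℕ} (r s : Fin n → Fin n → Fin n → Fin n) : Clause (Var n) → Set where
  wide : ∀ i → GGT r s (wideClause i)
  triPos : ∀ i j k → Distinct3 i j k → GGT r s (triClause i j k (x (r i j k) (s i j k)))
  triNeg : ∀ i j k → Distinct3 i j k → GGT r s (triClause i j k (compl (x (r i j k) (s i j k))))

module Submission where

open import Defs
open import Data.Nat using (ℕ; zero; suc; _+_; _*_; _≤_; _<_; _∸_; z≤n; s≤s)
import Data.Nat.Properties as ℕₚ
open import Data.Nat.Tactic.RingSolver using (solve-∀)
open import Data.Bool using (true; false)
import Data.Bool.Properties as Boolₚ
open import Data.Fin using (Fin; toℕ; fromℕ<; _≟_; _<?_)
import Data.Fin.Properties as Finₚ
open import Data.List using (List; []; _∷_; _++_; map; filter; length; allFin; cartesianProduct; upTo)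
import Data.List.Properties as Listₚ
open import Data.List.Membership.Propositional using (_∈_; _∉_; lose; find)
open import Data.List.Membership.Propositional.Properties
  using (∈-++⁺ˡ; ∈-++⁺ʳ; ∈-++⁻; ∈-filter⁺; ∈-filter⁻; ∈-map⁺; ∈-map⁻; ∈-allFin;
         ∈-cartesianProduct⁺; ∈-upTo⁺)
import Data.List.Membership.DecPropositional as DecMembership
open import Data.List.Relation.Unary.Any using (here; there; any?)
open import Data.List.Relation.Unary.All as All using ()
open import Data.List.Relation.Unary.AllPairs using ([]; _∷_)
open import Data.List.Relation.Unary.Unique.Propositional using (Unique)
open import Data.List.Relation.Unary.Unique.Propositional.Properties using (allFin⁺; filter⁺)
open import Data.List.Relation.Binary.Subset.Propositional using (_⊆_)
import Data.List.Relation.Binary.Subset.Propositional.Properties as Subset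
open import Data.Product using (Σ-syntax; _×_; _,_; proj₁; proj₂; ∃; ∃₂)
open import Data.Product.Properties using (≡-dec)
open import Data.Sum using (_⊎_; inj₁; inj₂; [_,_]′)
open import Data.Empty using (⊥-elim)
open import Function.Base using (id; _∘_)
open import Function.Bundles using (mk⇔)
open import Relation.Binary.Definitions using (DecidableEquality)
open import Relation.Nullary using (¬_; Dec; yes; no; ¬?; contradiction; _×-dec_; _⊎-dec_)
open import Relation.Binary.PropositionalEquality
  using (_≡_; _≢_; refl; sym; trans; cong; cong₂; subst)

-- GT_n has short regular dag-like refutations: the clause S(a, t), saying that
-- a is not a source among the vertices below t, follows from S(a, t + 1),
-- S(t, t + 1) and transitivity, and S(a, n) is a wide clause. Visiting the
-- clauses of this dag repeatedly turns it into a tree with input lemmas,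
-- provided every transitivity clause T_{i,j,k} used is a leaf.
--
-- The guarded T_{i,j,k} is obtained by resolving on its guard, which regularity
-- forbids once the guard has been queried. So the search keeps a set α of
-- queried edges, together with the set of roots, which have no incoming edge
-- and dominate all other vertices. While some relevant T_{i,j,k} is not yet
-- learned and its guard is not in α, branch on its three edges: the branch
-- where they form a cycle learns T_{i,j,k}, and each of the others loses a root
-- and is solved recursively. Otherwise every relevant T_{i,j,k} is a lemma, or
-- one of its two guarded versions has its guard literal falsified by α, and
-- the dag on the roots applies. Since there are n^3 clauses T_{i,j,k}, only
-- polynomially many dags are needed.
--
-- Weakening is not available, so both premises of every inference must contain
-- the pivot. This is ensured by a lower bound on the labels: at α, every edge
-- of α that leaves a root occurs negated.

-- Resolvents of clauses given as lists

module _ {V : Set} (_≟ⱽ_ : DecidableEquality V) where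

  _≟ˡ_ : DecidableEquality (Lit V)
  _≟ˡ_ = ≡-dec _≟ⱽ_ Boolₚ._≟_

  _∖_ : Clause V → Lit V → Clause V
  C ∖ ℓ = filter (λ l → ¬? (l ≟ˡ ℓ)) C

  -- The premise found under the assertion `ℓ` comes first, so `C` carries `compl ℓ` and `D` carries
  -- `ℓ`.
  resolvent : Lit V → Clause V → Clause V → Clause V
  resolvent ℓ C D = (C ∖ compl ℓ) ++ (D ∖ ℓ)

  resolvent-∈⁻ : ∀ {ℓ C D l} → l ∈ resolvent ℓ C D →
    ((l ∈ C) × (l ≢ compl ℓ)) ⊎ ((l ∈ D) × (l ≢ ℓ))
  resolvent-∈⁻ {ℓ} {C} l∈ with ∈-++⁻ (C ∖ compl ℓ) l∈
  ... | inj₁ p = inj₁ (∈-filter⁻ (λ l → ¬? (l ≟ˡ compl ℓ)) p)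
  ... | inj₂ p = inj₂ (∈-filter⁻ (λ l → ¬? (l ≟ˡ ℓ)) p)

  resolvent-∈⁺ : ∀ {ℓ C D l} →
    ((l ∈ C) × (l ≢ compl ℓ)) ⊎ ((l ∈ D) × (l ≢ ℓ)) → l ∈ resolvent ℓ C D
  resolvent-∈⁺ {ℓ} (inj₁ (p , q)) = ∈-++⁺ˡ (∈-filter⁺ (λ l → ¬? (l ≟ˡ compl ℓ)) p q)
  resolvent-∈⁺ {ℓ} {C} (inj₂ (p , q)) = ∈-++⁺ʳ (C ∖ compl ℓ) (∈-filter⁺ (λ l → ¬? (l ≟ˡ ℓ)) p q)

  -- `Res` wants the premise with the positive pivot first, so the sign of `ℓ` decides the order; a
  -- valid node admits both.
  resolvent-Res : ∀ ℓ {C D} → compl ℓ ∈ C → ℓ ∈ D → ℓ ∉ C → compl ℓ ∉ D →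
    Res (proj₁ ℓ) C D (resolvent ℓ C D) ⊎ Res (proj₁ ℓ) D C (resolvent ℓ C D)
  resolvent-Res (v , false) p q p′ q′ =
    inj₁ (p , q , p′ , q′ , λ l → mk⇔ resolvent-∈⁻ resolvent-∈⁺)
  resolvent-Res (v , true) {C} {D} p q p′ q′ =
    inj₂ (q , p , q′ , p′ , λ l → mk⇔ ([ inj₂ , inj₁ ]′ ∘ resolvent-∈⁻ {C = C} {D})
                                      (resolvent-∈⁺ {C = C} {D} ∘ [ inj₂ , inj₁ ]′))

-- Input derivations and the lemmas they provide

root-∈-inputConcls : ∀ {V} (T : Tree V) → isInput T ≡ true → label T ∈ inputConcls T
root-∈-inputConcls (leaf C) _ = here refl
root-∈-inputConcls (node C v L R) eq rewrite eq =
  ∈-++⁺ʳ (inputConcls L) (∈-++⁺ʳ (inputConcls R) (here refl))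

-- Whatever is available once both premises are finished remains available after the inference, so
-- lemmas found inside a subtree are kept.
node-concls : ∀ {V} {av : List (Clause V)} {C v} (L R : Tree V) →
  (av ++ inputConcls L) ++ inputConcls R ⊆ av ++ inputConcls (node C v L R)
node-concls {av = av} L R C∈ with ∈-++⁻ (av ++ inputConcls L) C∈
... | inj₂ h = ∈-++⁺ʳ av (∈-++⁺ʳ (inputConcls L) (∈-++⁺ˡ h))
... | inj₁ h with ∈-++⁻ av h
... | inj₁ g = ∈-++⁺ˡ g
... | inj₂ g = ∈-++⁺ʳ av (∈-++⁺ˡ g)

size-≥1 : ∀ {V} (T : Tree V) → 1 ≤ size T
size-≥1 (leaf _) = s≤s z≤n
size-≥1 (node _ _ _ _) = s≤s z≤n

-- Size bounds thereby also certify leaves, which is how the triangles of a chain are seen to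
-- preserve input derivations.
size-≤1⇒leaf : ∀ {V} (T : Tree V) → size T ≤ 1 → isLeaf T ≡ true
size-≤1⇒leaf (leaf _) _ = refl
size-≤1⇒leaf (node _ _ L R) (s≤s le) =
  contradiction (ℕₚ.≤-trans (ℕₚ.≤-trans (size-≥1 L) (ℕₚ.m≤m+n _ _)) le) λ ()

leaf⇒input : ∀ {V} (T : Tree V) → isLeaf T ≡ true → isInput T ≡ true
leaf⇒input (leaf _) _ = refl

-- Edges, their literals, and derivations with bounded labels

Edge : ℕ → Set
Edge n = Fin n × Fin n

Rel₂ : ℕ → Set₁
Rel₂ n = Fin n → Fin n → Set

module _ {n : ℕ} where

  var : Edge n → Var n
  var (a , b) = proj₁ (x a b)

  compl-x : ∀ {a b : Fin n} → a ≢ b → compl (x a b) ≡ x b a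
  compl-x {a} {b} a≢b with a <? b | b <? a
  ... | yes p | yes q = contradiction q (ℕₚ.<⇒≯ p)
  ... | yes p | no _ = refl
  ... | no _ | yes q = refl
  ... | no p | no q = contradiction (Finₚ.≤-antisym (ℕₚ.≮⇒≥ q) (ℕₚ.≮⇒≥ p)) a≢b

  x-injective : ∀ {a b c d : Fin n} → x a b ≡ x c d → a ≡ c × b ≡ d
  x-injective {a} {b} {c} {d} eq with a <? b | c <? d
  x-injective refl | yes _ | yes _ = refl , refl
  x-injective refl | no _ | no _ = refl , refl

  var-sym : ∀ {a b : Fin n} → a ≢ b → var (a , b) ≡ var (b , a)
  var-sym a≢b = cong proj₁ (compl-x a≢b)

  var-injective : ∀ {a b c d : Fin n} → a ≢ b → c ≢ d → var (a , b) ≡ var (c , d) →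
    (a ≡ c × b ≡ d) ⊎ (a ≡ d × b ≡ c)
  var-injective {a} {b} {c} {d} a≢b c≢d eq
    with proj₂ (x a b) Boolₚ.≟ proj₂ (x c d)
  ... | yes eq′ = inj₁ (x-injective (cong₂ _,_ eq eq′))
  ... | no neq = inj₂ (x-injective (trans (cong₂ _,_ eq (Boolₚ.¬-not neq)) (compl-x c≢d)))

  _≟ᵉ_ : DecidableEquality (Edge n)
  _≟ᵉ_ = ≡-dec _≟_ _≟_

  Irreflexive : Rel₂ n → Set
  Irreflexive B = ∀ {a b} → B a b → a ≢ b

  infixl 5 _⊕_
  _⊕_ : Rel₂ n → Edge n → Rel₂ n
  (B ⊕ (a , b)) c d = B c d ⊎ (c ≡ a × d ≡ b)

  Bounds : Rel₂ n → Rel₂ n → Clause (Var n) → Set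
  Bounds L B C =
    (∀ {a b} → L a b → x b a ∈ C) × (∀ {l} → l ∈ C → ∃₂ λ a b → a ≢ b × B a b × l ≡ x b a)

  -- A lemma is recorded by its bounds rather than by its exact literals, so it can replace any
  -- derivation that has to meet the same bounds.
  Available : List (Clause (Var n)) → Rel₂ n → Rel₂ n → Set
  Available av L B = Σ[ D ∈ Clause (Var n) ] (D ∈ av × Bounds L B D)

  spokes : Fin n → List (Fin n) → List (Edge n)
  spokes c = map (c ,_)

  infixl 5 _⊕⋆_
  _⊕⋆_ : Rel₂ n → Fin n × List (Fin n) → Rel₂ n
  (B ⊕⋆ (c , ks)) a b = B a b ⊎ (a ≡ c × b ∈ ks)

  -- Edges from one hub to different ends have different variables, so querying the spokes to `ks`
  -- leaves the one to `k` fresh.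
  map-var-∉ : ∀ {c k ks path} → c ≢ k → c ∉ ks → k ∉ ks →
    var (c , k) ∉ map var path → var (c , k) ∉ map var (spokes c ks ++ path)
  map-var-∉ {ks = []} _ _ _ h = h
  map-var-∉ {ks = j ∷ ks} c≢k c∉ k∉ h (here eq) with var-injective c≢k (λ c≡j → c∉ (here c≡j)) eq
  ... | inj₁ (_ , k≡j) = k∉ (here k≡j)
  ... | inj₂ (c≡j , _) = c∉ (here c≡j)
  map-var-∉ {ks = j ∷ ks} c≢k c∉ k∉ h (there p) =
    map-var-∉ c≢k (c∉ ∘ there) (k∉ ∘ there) h p

  -- What `resolve` and regularity require of the edges `c` → `k` before they can be asserted
  -- together and resolved away one by one.
  record Spokes (path : List (Edge n)) (B : Rel₂ n) (c : Fin n) (ks : List (Fin n)) : Set where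
    field
      hub    : c ∉ ks
      fresh  : ∀ {k} → k ∈ ks → var (c , k) ∉ map var path
      ¬out   : ∀ {k} → k ∈ ks → ¬ B c k
      ¬in    : ∀ {k} → k ∈ ks → ¬ B k c

  open Spokes public

  ≐-refl : ∀ {C : Clause (Var n)} → C ≐ C
  ≐-refl l = mk⇔ id id

  module _ (F : Clause (Var n) → Set) where

    -- A pair (a , b) is read as the assertion x_{a,b}. The label of the tree
    -- is falsified by the assertions in B, and it contains the negation
    -- x_{b,a} of every assertion in L.
    record Der (path : List (Edge n)) (av : List (Clause (Var n))) (L B : Rel₂ n) : Set where
      constructor der
      field
        tree  : Tree (Var n)
        valid : Valid F (map var path) av tree
        lower : ∀ {a b} → L a b → x b a ∈ label tree
        upper : ∀ {l} → l ∈ label tree → ∃₂ λ a b → a ≢ b × B a b × l ≡ x b a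

      concls : List (Clause (Var n))
      concls = inputConcls tree

  open Der public

  module _ {F : Clause (Var n) → Set} where

    bounds : ∀ {path av L B} (D : Der F path av L B) → Bounds L B (label (tree D))
    bounds D = lower D , upper D

    relax : ∀ {path av L L′ B B′} → (∀ {a b} → L′ a b → L a b) → (∀ {a b} → B a b → B′ a b) →
      Der F path av L B → Der F path av L′ B′
    relax f g (der t v lo up) =
      der t v (lo ∘ f) (λ l∈ → let a , b , a≢b , p , eq = up l∈ in a , b , a≢b , g p , eq)

    axiom : ∀ {path av L B C} → F C → Bounds L B C → Der F path av L B
    axiom {C = C} FC (lo , up) = der (leaf C) (inj₁ (C , FC , ≐-refl)) lo up

    lemmaLeaf : ∀ {path av L B} → Available av L B → Der F path av L B
    lemmaLeaf (C , C∈ , lo , up) = der (leaf C) (inj₂ (C , C∈ , ≐-refl)) lo up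

    -- `B` holds neither orientation of the edge, so removing the pivot leaves a label bounded by
    -- `B`. The lower bounds `L₁ a b` and `L₂ b a` put the pivot into both premises, and each
    -- literal demanded by `L` survives from one of them.
    resolve : ∀ {path av L₁ L₂ L B a b} → a ≢ b → Irreflexive B → ¬ B a b → ¬ B b a →
      var (a , b) ∉ map var path →
      (D₁ : Der F ((a , b) ∷ path) av L₁ (B ⊕ (a , b))) →
      (D₂ : Der F ((b , a) ∷ path) (av ++ concls D₁) L₂ (B ⊕ (b , a))) →
      L₁ a b → L₂ b a → (∀ {c d} → L c d → B c d × (L₁ c d ⊎ L₂ c d)) → Der F path av L B
    resolve {path} {L = L} {B} {a} {b} a≢b irr ¬Bab ¬Bba v∉ D₁ D₂ l₁ l₂ L⇒ =
      der (node C (var (a , b)) (tree D₁) (tree D₂))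
        (v∉ , resolvent-Res _≟ᵉ_ (x a b)
                (subst (_∈ label (tree D₁)) (sym (compl-x a≢b)) (lower D₁ l₁)) (lower D₂ l₂) ∉₁
                (∉₂ ∘ subst (_∈ label (tree D₂)) (compl-x a≢b))
            -- The second path records the reversed edge, which has the same variable.
            , valid D₁ , subst (λ v → Valid F (v ∷ map var path) _ (tree D₂)) (var-sym (a≢b ∘ sym)) (valid D₂))
        low up
      where
      C : Clause (Var n)
      C = resolvent _≟ᵉ_ (x a b) (label (tree D₁)) (label (tree D₂))
      -- A premise may contain the pivot with one sign only; the other sign would need an assertion
      -- of the reversed edge.
      ∉₁ : x a b ∉ label (tree D₁)
      ∉₁ p with upper D₁ p
      ... | c , d , c≢d , h , eq with x-injective eq
      ∉₁ p | _ , _ , c≢d , inj₁ h , eq | refl , refl = ¬Bba h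
      ∉₁ p | _ , _ , c≢d , inj₂ (h , _) , eq | refl , refl = a≢b (sym h)
      ∉₂ : x b a ∉ label (tree D₂)
      ∉₂ p with upper D₂ p
      ... | c , d , c≢d , h , eq with x-injective eq
      ∉₂ p | _ , _ , c≢d , inj₁ h , eq | refl , refl = ¬Bab h
      ∉₂ p | _ , _ , c≢d , inj₂ (h , _) , eq | refl , refl = a≢b h
      low : ∀ {c d} → L c d → x d c ∈ C
      low {c} {d} h with L⇒ h
      ... | Bcd , inj₁ h₁ = resolvent-∈⁺ _≟ᵉ_ {D = label (tree D₂)} (inj₁ (lower D₁ h₁ , λ eq →
              let d≡b , c≡a = x-injective (trans eq (compl-x a≢b)) in
              ¬Bab (subst (λ u → B u b) c≡a (subst (B c) d≡b Bcd))))
      ... | Bcd , inj₂ h₂ = resolvent-∈⁺ _≟ᵉ_ {C = label (tree D₁)} (inj₂ (lower D₂ h₂ , λ eq →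
              let d≡a , c≡b = x-injective eq in
              ¬Bba (subst (λ u → B u a) c≡b (subst (B c) d≡a Bcd))))
      up : ∀ {l} → l ∈ C → ∃₂ λ c d → c ≢ d × B c d × l ≡ x d c
      up l∈ with resolvent-∈⁻ _≟ᵉ_ l∈
      up l∈ | inj₁ (p , q) with upper D₁ p
      ... | c , d , c≢d , inj₁ h , eq = c , d , c≢d , h , eq
      ... | c , d , c≢d , inj₂ (refl , refl) , eq = ⊥-elim (q (trans eq (sym (compl-x a≢b))))
      up l∈ | inj₂ (p , q) with upper D₂ p
      ... | c , d , c≢d , inj₁ h , eq = c , d , c≢d , h , eq
      ... | c , d , c≢d , inj₂ (refl , refl) , eq = ⊥-elim (q eq)

    -- Chains of resolutions with triangles

    record Chain {path path′ av L₀ B₀} (base : Der F path′ av L₀ B₀) (L B : Rel₂ n) (len s : ℕ) : Set where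
      constructor mkChain
      field
        result : Der F path av L B
        size-≤ : size (tree result) ≤ size (tree base) + len * suc s
        base-⊆ : concls base ⊆ concls result
        input  : s ≤ 1 → isInput (tree base) ≡ true → isInput (tree result) ≡ true

    open Chain public

    -- Spokes are resolved away in list order, so next to the triangle for `k` only those of the
    -- tail `ks′` are still asserted. `av′` allows for lemmas found in the premise that precedes the
    -- triangle.
    TriangleDers : List (Edge n) → List (Clause (Var n)) → Rel₂ n → Fin n → List (Fin n) → ℕ → Set
    TriangleDers path av B c ks s = ∀ {k ks′} → (k ∷ ks′) ⊆ ks → k ∉ ks′ → ∀ {av′} → av ⊆ av′ →
      Σ[ D ∈ Der F ((k , c) ∷ spokes c ks′ ++ path) av′ (λ a b → a ≡ k × b ≡ c)
                 (B ⊕⋆ (c , ks′) ⊕ (k , c)) ]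
        size (tree D) ≤ s

    -- Eliminates the edges c → k, for k in ks, by resolving with triangles through
    -- k → c; if every triangle is a leaf then input derivations are preserved.
    chain : ∀ {path av L B c s} ks → Unique ks → Irreflexive B → Spokes path B c ks → ∀ {L₀} →
      (base : Der F (spokes c ks ++ path) av L₀ (B ⊕⋆ (c , ks))) →
      (∀ {k} → k ∈ ks → L₀ c k) → (∀ {a b} → L a b → B a b × L₀ a b) →
      TriangleDers path av B c ks s → Chain {path} base L B (length ks) s
    chain {B = B} [] _ _ _ base _ L⇒ _ =
      mkChain (relax (proj₂ ∘ L⇒) (λ { (inj₁ h) → h ; (inj₂ (_ , ())) }) base)
              (ℕₚ.m≤m+n _ 0) id (λ _ h → h)
    chain {path} {av} {L} {B} {c} {s} (k ∷ ks) (k# ∷ unique) irr sp {L₀} base pivots L⇒ tri =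
      mkChain (result rest) bound (base-⊆ rest ∘ base⊆step) inp
      where
      k∉ : k ∉ ks
      k∉ k∈ = All.lookup k# k∈ refl
      c≢k : c ≢ k
      c≢k c≡k = hub sp (here c≡k)
      B′ : Rel₂ n
      B′ = B ⊕⋆ (c , ks)
      irr′ : Irreflexive B′
      irr′ (inj₁ h) = irr h
      irr′ (inj₂ (refl , b∈)) refl = hub sp (there b∈)
      base′ : Der F ((c , k) ∷ spokes c ks ++ path) av L₀ (B′ ⊕ (c , k))
      base′ = relax id (λ { (inj₁ h) → inj₁ (inj₁ h)
                          ; (inj₂ (eq , here eq′)) → inj₂ (eq , eq′)
                          ; (inj₂ (eq , there h)) → inj₁ (inj₂ (eq , h)) }) base
      T : Σ[ D ∈ Der F ((k , c) ∷ spokes c ks ++ path) (av ++ concls base) (λ a b → a ≡ k × b ≡ c)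
                     (B′ ⊕ (k , c)) ] size (tree D) ≤ s
      T = tri id k∉ ∈-++⁺ˡ
      step : Der F (spokes c ks ++ path) av (λ a b → B′ a b × L₀ a b) B′
      step = resolve c≢k irr′
        (λ { (inj₁ h) → ¬out sp (here refl) h ; (inj₂ (_ , h)) → k∉ h })
        (λ { (inj₁ h) → ¬in sp (here refl) h ; (inj₂ (h , _)) → c≢k (sym h) })
        (map-var-∉ c≢k (hub sp ∘ there) k∉ (fresh sp (here refl)))
        base′ (proj₁ T) (pivots (here refl)) (refl , refl) (λ { (h , l) → h , inj₁ l })
      base⊆step : concls base ⊆ concls step
      base⊆step = ∈-++⁺ˡ
      rest : Chain {path} step L B (length ks) s
      rest = chain ks unique irr
        (record { hub = hub sp ∘ there ; fresh = fresh sp ∘ there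
                ; ¬out = ¬out sp ∘ there ; ¬in = ¬in sp ∘ there })
        step (λ h → inj₂ (refl , h) , pivots (there h))
        (λ l → let b , l₀ = L⇒ l in b , inj₁ b , l₀)
        (λ sub → tri (there ∘ sub))
      bound : size (tree (result rest)) ≤ size (tree base) + suc (length ks) * suc s
      bound = begin
        size (tree (result rest))
          ≤⟨ size-≤ rest ⟩
        suc (size (tree base) + size (tree (proj₁ T))) + length ks * suc s
          ≤⟨ ℕₚ.+-monoˡ-≤ _ (s≤s (ℕₚ.+-monoʳ-≤ (size (tree base)) (proj₂ T))) ⟩
        suc (size (tree base) + s) + length ks * suc s
          ≡⟨ cong (_+ length ks * suc s) (ℕₚ.+-suc (size (tree base)) s) ⟨
        (size (tree base) + suc s) + length ks * suc s
          ≡⟨ ℕₚ.+-assoc (size (tree base)) (suc s) _ ⟩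
        size (tree base) + suc (length ks) * suc s ∎
        where open ℕₚ.≤-Reasoning
      inp : s ≤ 1 → isInput (tree base) ≡ true → isInput (tree (result rest)) ≡ true
      inp s≤1 h = input rest s≤1 input-step
        where
        leafT : isLeaf (tree (proj₁ T)) ≡ true
        leafT = size-≤1⇒leaf _ (ℕₚ.≤-trans (proj₂ T) s≤1)
        input-step : isInput (tree step) ≡ true
        input-step rewrite leafT | h | leaf⇒input (tree (proj₁ T)) leafT
                         | Boolₚ.∨-zeroʳ (isLeaf (tree base)) = refl

length-cartesianProduct : ∀ {A B : Set} (as : List A) (bs : List B) →
  length (cartesianProduct as bs) ≡ length as * length bs
length-cartesianProduct [] bs = refl
length-cartesianProduct (a ∷ as) bs =
  trans (Listₚ.length-++ (map (a ,_) bs))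
        (cong₂ _+_ (Listₚ.length-map (a ,_) bs) (length-cartesianProduct as bs))

-- Guarded transitivity clauses

module GuardedTautology {n : ℕ} {r s : Fin n → Fin n → Fin n → Fin n} (guards : Guards r s) where

  open DecMembership (_≟_ {n}) using () renaming (_∈?_ to _∈ᶠ?_)
  open DecMembership (_≟ᵉ_ {n}) using () renaming (_∈?_ to _∈ᵉ?_)

  F : Clause (Var n) → Set
  F = GGT r s

  Tri : Fin n → Fin n → Fin n → Rel₂ n
  Tri i j k a b = (a ≡ i × b ≡ j) ⊎ (a ≡ j × b ≡ k) ⊎ (a ≡ k × b ≡ i)

  Tri⇒In3 : ∀ {i j k a b} → Tri i j k a b → In3 a i j k × In3 b i j k
  Tri⇒In3 (inj₁ (p , q)) = inj₁ p , inj₂ (inj₁ q)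
  Tri⇒In3 (inj₂ (inj₁ (p , q))) = inj₂ (inj₁ p) , inj₂ (inj₂ q)
  Tri⇒In3 (inj₂ (inj₂ (p , q))) = inj₂ (inj₂ p) , inj₁ q

  Tri-irr : ∀ {i j k} → Distinct3 i j k → Irreflexive (Tri i j k)
  Tri-irr (i≢j , _ , _) (inj₁ (refl , refl)) = i≢j
  Tri-irr (_ , j≢k , _) (inj₂ (inj₁ (refl , refl))) = j≢k
  Tri-irr (_ , _ , k≢i) (inj₂ (inj₂ (refl , refl))) = k≢i

  var∉ : ∀ {a b : Fin n} {path} → a ≢ b → (∀ {c d} → (c , d) ∈ path → c ≢ d) →
    (a , b) ∉ path → (b , a) ∉ path → var (a , b) ∉ map var path
  var∉ a≢b irr p q v∈ with ∈-map⁻ var v∈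
  ... | (c , d) , cd∈ , eq with var-injective a≢b (irr cd∈) eq
  ... | inj₁ (refl , refl) = p cd∈
  ... | inj₂ (refl , refl) = q cd∈

  guard : Fin n → Fin n → Fin n → Edge n
  guard i j k = r i j k , s i j k

  module _ {i j k : Fin n} (dist : Distinct3 i j k) where
    private
      i≢j = proj₁ dist
      j≢k = proj₁ (proj₂ dist)
      k≢i = proj₂ (proj₂ dist)

    r≢s : r i j k ≢ s i j k
    r≢s = proj₁ (guards i j k dist)

    -- Both ends of an edge of the cycle lie among `i`, `j`, `k`, while the guard has an end
    -- outside.
    guard∉Tri : ∀ {a b} → Tri i j k a b → (r i j k , s i j k) ≢ (a , b) × (s i j k , r i j k) ≢ (a , b)
    guard∉Tri t = (λ { refl → proj₁ (proj₂ (guards i j k dist)) (Tri⇒In3 t) })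
                , (λ { refl → let p , q = Tri⇒In3 t in proj₁ (proj₂ (guards i j k dist)) (q , p) })

    triBounds : ∀ {p q} → p ≢ q →
      Bounds (Tri i j k ⊕ (p , q)) (Tri i j k ⊕ (p , q)) (triClause i j k (x q p))
    triBounds p≢q
      rewrite compl-x i≢j | compl-x j≢k | compl-x k≢i =
      (λ { (inj₁ (inj₁ (refl , refl))) → here refl
         ; (inj₁ (inj₂ (inj₁ (refl , refl)))) → there (here refl)
         ; (inj₁ (inj₂ (inj₂ (refl , refl)))) → there (there (here refl))
         ; (inj₂ (refl , refl)) → there (there (there (here refl))) }) ,
      (λ { (here eq) → _ , _ , i≢j , inj₁ (inj₁ (refl , refl)) , eq
         ; (there (here eq)) → _ , _ , j≢k , inj₁ (inj₂ (inj₁ (refl , refl))) , eq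
         ; (there (there (here eq))) → _ , _ , k≢i , inj₁ (inj₂ (inj₂ (refl , refl))) , eq
         ; (there (there (there (here eq)))) → _ , _ , p≢q , inj₂ (refl , refl) , eq })

    -- Asserting the guard edge falsifies the negated guard literal, hence the use of `triNeg`.
    guardTrue : ∀ {path av} →
      Der F path av (Tri i j k ⊕ (r i j k , s i j k)) (Tri i j k ⊕ (r i j k , s i j k))
    guardTrue = axiom (triNeg i j k dist)
      (subst (λ ℓ → Bounds (Tri i j k ⊕ guard i j k) (Tri i j k ⊕ guard i j k) (triClause i j k ℓ))
        (sym (compl-x r≢s)) (triBounds r≢s))

    guardFalse : ∀ {path av} →
      Der F path av (Tri i j k ⊕ (s i j k , r i j k)) (Tri i j k ⊕ (s i j k , r i j k))
    guardFalse = axiom (triPos i j k dist) (triBounds (r≢s ∘ sym))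

    triangle : ∀ {path av} → var (guard i j k) ∉ map var path → Der F path av (Tri i j k) (Tri i j k)
    triangle fresh = resolve r≢s (Tri-irr dist)
      (λ t → proj₁ (guard∉Tri t) refl) (λ t → proj₂ (guard∉Tri t) refl) fresh
      guardTrue guardFalse (inj₂ (refl , refl)) (inj₂ (refl , refl)) (λ t → t , inj₁ (inj₁ t))

    TriWith : List (Edge n) → Rel₂ n
    TriWith path a b = Tri i j k a b ⊎ (a , b) ∈ path

    triangleOn : ∀ {path path′ av} → (guard i j k ∈ path) ⊎ ((s i j k , r i j k) ∈ path) →
      Σ[ D ∈ Der F path′ av (Tri i j k) (TriWith path) ] size (tree D) ≤ 1
    triangleOn (inj₁ h) = relax inj₁ (λ { (inj₁ t) → inj₁ t ; (inj₂ (refl , refl)) → inj₂ h }) guardTrue , s≤s z≤n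
    triangleOn (inj₂ h) = relax inj₁ (λ { (inj₁ t) → inj₁ t ; (inj₂ (refl , refl)) → inj₂ h }) guardFalse , s≤s z≤n

    guardOn? : ∀ {path} → (∀ {a b} → (a , b) ∈ path → a ≢ b) →
      ((guard i j k ∈ path) ⊎ ((s i j k , r i j k) ∈ path)) ⊎ (var (guard i j k) ∉ map var path)
    guardOn? {path} irr with guard i j k ∈ᵉ? path | (s i j k , r i j k) ∈ᵉ? path
    ... | yes p | _ = inj₁ (inj₁ p)
    ... | no _ | yes q = inj₁ (inj₂ q)
    ... | no p | no q = inj₂ (var∉ r≢s irr p q)

    -- Size 3 covers both cases: one axiom if the guard is queried, otherwise one inference on the
    -- guard from two axioms.
    triangleAny : ∀ {path av} → (∀ {a b} → (a , b) ∈ path → a ≢ b) →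
      Σ[ D ∈ Der F path av (Tri i j k) (TriWith path) ] size (tree D) ≤ 3
    triangleAny irr with guardOn? irr
    ... | inj₁ on = let D , le = triangleOn on in D , ℕₚ.≤-trans le (s≤s z≤n)
    ... | inj₂ fresh = relax id inj₁ (triangle fresh) , ℕₚ.≤-refl

  -- States of the search

  -- `rem` lists the vertices that have stopped being roots; the roots are kept implicitly as its
  -- complement.
  record State (α : List (Edge n)) (rem : List (Fin n)) : Set where
    field
      irr    : ∀ {a b} → (a , b) ∈ α → a ≢ b
      ¬into  : ∀ {a b} → b ∉ rem → (a , b) ∉ α
      parent : ∀ {k} → k ∈ rem → ∃ λ d → d ∉ rem × (d , k) ∈ α

  open State

  -- These are the only transitivity clauses that occur in the dag on the roots.
  Needed : List (Edge n) → List (Fin n) → Fin n → Fin n → Fin n → Set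
  Needed α rem i j k =
    i ∉ rem × j ∉ rem × Distinct3 i j k × (k ∉ rem ⊎ ((j , k) ∈ α × (i , k) ∉ α))

  -- A leaf meets every regularity condition, so readiness can be asked for at all paths, and it
  -- survives the arrival of further lemmas.
  TriReady : List (Edge n) → List (Fin n) → List (Clause (Var n)) → Set
  TriReady α rem av = ∀ {i j k} → Needed α rem i j k → ∀ {path av′} → av ⊆ av′ →
    Σ[ D ∈ Der F path av′ (Tri i j k) (λ a b → Tri i j k a b ⊎ (a , b) ∈ α) ] size (tree D) ≤ 1

  remove : ∀ {A : Set} → DecidableEquality A → A → List A → List A
  remove _≟ᴬ_ a = filter (λ b → ¬? (b ≟ᴬ a))

  length-remove : ∀ {A : Set} (_≟ᴬ_ : DecidableEquality A) {a as} → a ∈ as →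
    length (remove _≟ᴬ_ a as) < length as
  length-remove _≟ᴬ_ {a} {as} a∈ = Listₚ.filter-notAll (λ b → ¬? (b ≟ᴬ a)) as (lose a∈ (λ h → h refl))

  ∉-remove : ∀ {A : Set} (_≟ᴬ_ : DecidableEquality A) {a b as} →
    b ∉ remove _≟ᴬ_ a as → (b ≡ a) ⊎ (b ∉ as)
  ∉-remove _≟ᴬ_ {a} {b} b∉ with b ≟ᴬ a
  ... | yes eq = inj₁ eq
  ... | no neq = inj₂ (λ b∈ → b∉ (∈-filter⁺ (λ c → ¬? (c ≟ᴬ a)) b∈ neq))

  length-filter-Fin : ∀ {P : Fin n → Set} (P? : ∀ a → Dec (P a)) → length (filter P? (allFin n)) ≤ n
  length-filter-Fin P? =
    ℕₚ.≤-trans (Listₚ.length-filter P? (allFin n)) (ℕₚ.≤-reflexive (Listₚ.length-tabulate id))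

  rate : ℕ
  rate = 2 + n * 2

  -- The transitivity dag on the roots

  module Inner {α rem av₀} (st : State α rem) (ready : TriReady α rem av₀) where

    -- The second part of Lower covers the edges of α leaving the roots whose
    -- wide clauses are used to derive S(a, t); for the least root a and
    -- t = a + 1 that is every root.
    Lower Upper : Fin n → ℕ → Rel₂ n
    Lower a t c d =
      (c ≡ a × d ∉ rem × toℕ d < t × d ≢ a) ⊎ (c ∉ rem × (c , d) ∈ α × (c ≡ a ⊎ t ≤ toℕ c))
    Upper a t c d =
      (c ≡ a × d ∉ rem × toℕ d < t × d ≢ a) ⊎ (c , d) ∈ α

    Upper-irr : ∀ {a t} → Irreflexive (Upper a t)
    Upper-irr (inj₁ (refl , _ , _ , d≢a)) = d≢a ∘ sym
    Upper-irr (inj₂ h) = irr st h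

    Lower⇒Upper : ∀ {a t c d} → Lower a t c d → Upper a t c d
    Lower⇒Upper (inj₁ h) = inj₁ h
    Lower⇒Upper (inj₂ (_ , h , _)) = inj₂ h

    -- These are the variables that a derivation starting at level `t` may still resolve on: edges
    -- between roots with an end at level `t` or above, and edges to non-roots outside `α`.
    record Fresh (path : List (Edge n)) (t : ℕ) : Set where
      field
        roots  : ∀ {b d} → b ∉ rem → d ∉ rem → b ≢ d → t ≤ toℕ d → var (b , d) ∉ map var path
        others : ∀ {b k} → b ∉ rem → k ∈ rem → (b , k) ∉ α → var (b , k) ∉ map var path

    open Fresh

    -- The wide clause of `a` also speaks of non-roots. An edge `a` → `k` to a non-root outside `α`
    -- is removed by the triangle `a` → `d` → `k` → `a`, where the root `d` is a parent of `k`.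
    wideChain : ∀ {a path av} → a ∉ rem → Fresh path n → av₀ ⊆ av →
      Σ[ D ∈ Der F path av (Lower a n) (Upper a n) ]
        (size (tree D) ≤ 1 + n * 2) × (isInput (tree D) ≡ true)
    wideChain {a} {path} {av} a∉ fr av₀⊆ =
      result ch , ℕₚ.≤-trans (size-≤ ch) (s≤s (ℕₚ.*-monoˡ-≤ 2 (length-filter-Fin K?))) , input ch ℕₚ.≤-refl refl
      where
      K? : ∀ k → Dec (k ∈ rem × (a , k) ∉ α)
      K? k = (k ∈ᶠ? rem) ×-dec ¬? ((a , k) ∈ᵉ? α)
      K : List (Fin n)
      K = filter K? (allFin n)
      K⁻ : ∀ {k} → k ∈ K → k ∈ rem × (a , k) ∉ α
      K⁻ h = proj₂ (∈-filter⁻ K? {xs = allFin n} h)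
      a∉K : a ∉ K
      a∉K h = a∉ (proj₁ (K⁻ h))
      wideBounds : Bounds (λ c d → c ≡ a × d ≢ a) (λ c d → c ≡ a × d ≢ a) (wideClause a)
      wideBounds =
        (λ { {_} {d} (refl , d≢a) → ∈-map⁺ (λ j → x j a) (∈-filter⁺ (λ j → ¬? (j ≟ a)) (∈-allFin d) d≢a) }) ,
        (λ l∈ → let j , j∈ , eq = ∈-map⁻ (λ j → x j a) l∈
                    j≢a = proj₂ (∈-filter⁻ (λ j → ¬? (j ≟ a)) {xs = allFin n} j∈)
                in a , j , j≢a ∘ sym , (refl , j≢a) , eq)
      classify : ∀ {c d} → c ≡ a × d ≢ a → (Upper a n ⊕⋆ (a , K)) c d
      classify {_} {d} (refl , d≢a) with d ∈ᶠ? rem | (a , d) ∈ᵉ? α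
      ... | no d∉ | _ = inj₁ (inj₁ (refl , d∉ , Finₚ.toℕ<n d , d≢a))
      ... | yes _ | yes e = inj₁ (inj₂ e)
      ... | yes d∈ | no ¬e = inj₂ (refl , ∈-filter⁺ K? (∈-allFin d) (d∈ , ¬e))
      base : Der F (spokes a K ++ path) av (λ c d → c ≡ a × d ≢ a) (Upper a n ⊕⋆ (a , K))
      base = relax id classify (axiom (wide a) wideBounds)
      tri : TriangleDers path av (Upper a n) a K 1
      tri {k} sub _ av⊆ with K⁻ (sub (here refl))
      ... | k∈ , ¬e with parent st k∈
      -- The parent `d` differs from `a`, because `α` contains `d` → `k` but not `a` → `k`.
      ... | d , d∉ , dk with ready {a} {d} {k}
               (a∉ , d∉ , ((λ { refl → ¬e dk }) , irr st dk , λ { refl → a∉ k∈ }) , inj₂ (dk , ¬e))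
               (av⊆ ∘ av₀⊆)
      ... | D , le = relax (λ { (refl , refl) → inj₂ (inj₂ (refl , refl)) })
          (λ { (inj₁ (inj₁ (refl , refl))) →
                 inj₁ (inj₁ (inj₁ (refl , d∉ , Finₚ.toℕ<n d , λ { refl → ¬e dk })))
             ; (inj₁ (inj₂ (inj₁ (refl , refl)))) → inj₁ (inj₁ (inj₂ dk))
             ; (inj₁ (inj₂ (inj₂ (refl , refl)))) → inj₂ (refl , refl)
             ; (inj₂ h) → inj₁ (inj₁ (inj₂ h)) }) D , le
      covered : ∀ {c d} → Lower a n c d → c ≡ a × d ≢ a
      covered (inj₁ (refl , _ , _ , d≢a)) = refl , d≢a
      covered (inj₂ (_ , e , inj₁ refl)) = refl , irr st e ∘ sym
      covered (inj₂ (_ , _ , inj₂ le)) = contradiction le (ℕₚ.<⇒≱ (Finₚ.toℕ<n _))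
      ch : Chain {path = path} base (Lower a n) (Upper a n) (length K) 1
      ch = chain K (filter⁺ K? (allFin⁺ n)) Upper-irr
        (record { hub = a∉K
                ; fresh = λ h → let k∈ , ¬e = K⁻ h in others fr a∉ k∈ ¬e
                ; ¬out = λ { h (inj₁ (_ , d∉ , _)) → d∉ (proj₁ (K⁻ h)) ; h (inj₂ e) → proj₂ (K⁻ h) e }
                ; ¬in = λ { h (inj₁ (_ , _ , _ , a≢a)) → a≢a refl ; h (inj₂ e) → ¬into st a∉ e } })
        base (λ h → refl , λ { refl → a∉K h })
        (λ h → Lower⇒Upper h , covered h)
        tri

    -- (a , t) stands for the dag node with bounds Lower a t and Upper a t.
    LemmaIndex : Set
    LemmaIndex = Fin n × ℕ

    _≟ᵢ_ : DecidableEquality LemmaIndex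
    _≟ᵢ_ = ≡-dec _≟_ ℕₚ._≟_

    open DecMembership _≟ᵢ_ using () renaming (_∈?_ to _∈ⁱ?_)

    Learned : List (Clause (Var n)) → List LemmaIndex → Set
    Learned av todo = ∀ {a t} → a ∉ rem → t ≤ n → (a , t) ∉ todo → Available av (Lower a t) (Upper a t)

    learned-⊆ : ∀ {av av′ todo} → av ⊆ av′ → Learned av todo → Learned av′ todo
    learned-⊆ sub l a∉ t≤ ∉todo = let C , C∈ , b = l a∉ t≤ ∉todo in C , sub C∈ , b

    learned-remove : ∀ {av todo a t} → Learned av todo → Available av (Lower a t) (Upper a t) →
      Learned av (remove _≟ᵢ_ (a , t) todo)
    learned-remove {todo = todo} {a} {t} l new {a′} {t′} a∉ t≤ ∉todo
      with ∉-remove _≟ᵢ_ {a , t} {a′ , t′} {todo} ∉todo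
    ... | inj₁ refl = new
    ... | inj₂ ∉ = l a∉ t≤ ∉

    -- A call that is not answered by a known lemma makes at least one new
    -- clause available: its own label if both recursive calls are answered by
    -- lemmas, a deeper one otherwise. A new lemma is thus charged by at most
    -- one call per level.
    record Outcome (a : Fin n) (t : ℕ) (path : List (Edge n)) (av : List (Clause (Var n)))
                   (todo : List LemmaIndex) (h : ℕ) : Set where
      constructor outcome
      field
        out      : Der F path av (Lower a t) (Upper a t)
        todo′    : List LemmaIndex
        learned′ : Learned (av ++ concls out) todo′
        gain     : ℕ
        shrink   : length todo′ + gain ≤ length todo
        bound    : size (tree out) ≤ 1 + rate * (suc h * gain)
        progress : (isLeaf (tree out) ≡ true × todo′ ≡ todo) ⊎ 1 ≤ gain

    open Outcome

    learnRoot : ∀ {a t path av av′ todo} (D : Der F path av (Lower a t) (Upper a t)) →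
      isInput (tree D) ≡ true → av′ ⊆ av ++ concls D → Learned av′ todo →
      Learned (av ++ concls D) (remove _≟ᵢ_ (a , t) todo)
    learnRoot {av = av} D inp sub l = learned-remove (learned-⊆ sub l)
      (label (tree D) , ∈-++⁺ʳ av (root-∈-inputConcls (tree D) inp) , bounds D)

    recall : ∀ {a t path av todo h} → a ∉ rem → t ≤ n → Learned av todo → (a , t) ∉ todo →
      Outcome a t path av todo h
    recall a∉ t≤ l ∉todo = outcome (lemmaLeaf (l a∉ t≤ ∉todo)) _ (learned-⊆ ∈-++⁺ˡ l) 0
      (ℕₚ.≤-reflexive (ℕₚ.+-identityʳ _)) (s≤s z≤n) (inj₁ (refl , refl))

    bottom : ∀ {a path av todo} → a ∉ rem → Fresh path n → av₀ ⊆ av → Learned av todo →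
      (a , n) ∈ todo → Outcome a n path av todo 0
    bottom a∉ fr av₀⊆ l ∈todo with wideChain a∉ fr av₀⊆
    ... | D , le , inp = outcome D _
      (learnRoot D inp ∈-++⁺ˡ l) 1
      (ℕₚ.≤-trans (ℕₚ.≤-reflexive (ℕₚ.+-comm _ 1)) (length-remove _≟ᵢ_ ∈todo))
      (ℕₚ.≤-trans le (s≤s (ℕₚ.≤-trans (ℕₚ.m≤n+m _ 2) (ℕₚ.≤-reflexive (sym (ℕₚ.*-identityʳ rate))))))
      (inj₂ ℕₚ.≤-refl)

    -- The bounds compare only roots with the level, so at a non-root `τ` the levels `τ` and `τ` + 1
    -- agree and no inference is made.
    skip : ∀ {a path av todo h} (τ : Fin n) → τ ∈ rem →
      Outcome a (suc (toℕ τ)) path av todo h → Outcome a (toℕ τ) path av todo (suc h)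
    skip τ τ∈ o = record
      { out = relax
          (λ { (inj₁ (eq , d∉ , lt , ne)) → inj₁ (eq , d∉ , ℕₚ.m<n⇒m<1+n lt , ne)
             ; (inj₂ (c∉ , e , inj₁ eq)) → inj₂ (c∉ , e , inj₁ eq)
             ; (inj₂ (c∉ , e , inj₂ le)) →
                 inj₂ (c∉ , e , inj₂ (ℕₚ.≤∧≢⇒< le (λ eq → c∉ (subst (_∈ rem) (Finₚ.toℕ-injective eq) τ∈)))) })
          (λ { (inj₁ (eq , d∉ , lt , ne)) →
                 inj₁ (eq , d∉ , ℕₚ.≤∧≢⇒< (ℕₚ.≤-pred lt) (λ eq′ → d∉ (subst (_∈ rem) (sym (Finₚ.toℕ-injective eq′)) τ∈)) , ne)
             ; (inj₂ e) → inj₂ e })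
          (out o)
      ; todo′ = todo′ o ; learned′ = learned′ o ; gain = gain o ; shrink = shrink o
      ; bound = ℕₚ.≤-trans (bound o) (s≤s (ℕₚ.*-monoʳ-≤ rate (ℕₚ.m≤n+m _ (gain o))))
      ; progress = progress o }

    -- `rate` pays for the new node, the constant 1 of one premise, and at most `n` triangles of a
    -- leaf and a node each. Since `d` is positive it covers this once; the premises charge the same
    -- gains on their own `h` levels.
    combine-≤ : ∀ {h d₁ d₂ d s₁ s₂ s₃ l} → s₁ ≤ 1 + rate * (h * d₁) → s₂ ≤ 1 + rate * (h * d₂) →
      s₃ ≤ s₂ + l * 2 → l ≤ n → d₁ + d₂ ≤ d → 1 ≤ d → suc (s₁ + s₃) ≤ 1 + rate * (suc h * d)
    combine-≤ {h} {d₁} {d₂} {d} {s₁} {s₂} {s₃} {l} b₁ b₂ b₃ l≤n d₁₂≤d 1≤d = begin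
      suc (s₁ + s₃)
        ≤⟨ s≤s (ℕₚ.+-mono-≤ b₁ (ℕₚ.≤-trans b₃ (ℕₚ.+-mono-≤ b₂ (ℕₚ.*-monoˡ-≤ 2 l≤n)))) ⟩
      suc ((1 + rate * (h * d₁)) + ((1 + rate * (h * d₂)) + n * 2))
        ≡⟨ rearrange n h d₁ d₂ ⟩
      1 + rate * (1 + h * (d₁ + d₂))
        ≤⟨ s≤s (ℕₚ.*-monoʳ-≤ rate (ℕₚ.+-mono-≤ 1≤d (ℕₚ.*-monoʳ-≤ h d₁₂≤d))) ⟩
      1 + rate * (suc h * d) ∎
      where
      open ℕₚ.≤-Reasoning
      rearrange : ∀ m h d₁ d₂ →
        suc ((1 + (2 + m * 2) * (h * d₁)) + ((1 + (2 + m * 2) * (h * d₂)) + m * 2)) ≡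
        1 + (2 + m * 2) * (1 + h * (d₁ + d₂))
      rearrange = solve-∀

    module Branch {a τ : Fin n} {path : List (Edge n)} {av : List (Clause (Var n))} {todo : List LemmaIndex}
      {h : ℕ} (a∉ : a ∉ rem) (τ∉ : τ ∉ rem) (a<τ : toℕ a < toℕ τ) (fr : Fresh path (toℕ τ)) (av₀⊆ : av₀ ⊆ av) where

      t : ℕ
      t = toℕ τ

      a≢τ : a ≢ τ
      a≢τ refl = ℕₚ.<-irrefl refl a<τ

      K? : ∀ b → Dec (b ∉ rem × toℕ b < t × b ≢ a)
      K? b = ¬? (b ∈ᶠ? rem) ×-dec ((toℕ b ℕₚ.<? t) ×-dec ¬? (b ≟ a))

      K : List (Fin n)
      K = filter K? (allFin n)

      K⁻ : ∀ {b} → b ∈ K → b ∉ rem × toℕ b < t × b ≢ a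
      K⁻ b∈ = proj₂ (∈-filter⁻ K? {xs = allFin n} b∈)

      τ∉K : τ ∉ K
      τ∉K τ∈ = ℕₚ.<-irrefl refl (proj₁ (proj₂ (K⁻ τ∈)))

      path₁ path₂ path₃ : List (Edge n)
      path₁ = (a , τ) ∷ path
      path₂ = (τ , a) ∷ path
      path₃ = spokes τ K ++ path₂

      -- The new edge joins two roots at levels at most `t`, so it is none of the variables reserved
      -- for level `t` + 1.
      fresh-∷ : ∀ {p q path′} → p ∉ rem → q ∉ rem → p ≢ q → toℕ p ≤ t → toℕ q ≤ t →
        Fresh path′ (suc t) → Fresh ((p , q) ∷ path′) (suc t)
      fresh-∷ {p} {q} p∉ q∉ p≢q p≤ q≤ fr′ = record { roots = rts ; others = oth }
        where
        rts : ∀ {b d} → b ∉ rem → d ∉ rem → b ≢ d → suc t ≤ toℕ d → var (b , d) ∉ _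
        rts b∉ d∉ b≢d lt (there h) = roots fr′ b∉ d∉ b≢d lt h
        rts {b} {d} b∉ d∉ b≢d lt (here eq) with var-injective {a = b} {d} {p} {q} b≢d p≢q eq
        ... | inj₁ (_ , refl) = ℕₚ.<⇒≱ lt q≤
        ... | inj₂ (_ , refl) = ℕₚ.<⇒≱ lt p≤
        oth : ∀ {b k} → b ∉ rem → k ∈ rem → (b , k) ∉ α → var (b , k) ∉ _
        oth b∉ k∈ ¬e (there h) = others fr′ b∉ k∈ ¬e h
        oth {b} {k} b∉ k∈ ¬e (here eq) with var-injective {a = b} {k} {p} {q} (λ { refl → b∉ k∈ }) p≢q eq
        ... | inj₁ (_ , refl) = q∉ k∈
        ... | inj₂ (_ , refl) = p∉ k∈

      fresh-suc : Fresh path (suc t)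
      fresh-suc = record { roots = λ b∉ d∉ b≢d lt → roots fr b∉ d∉ b≢d (ℕₚ.<⇒≤ lt) ; others = others fr }

      fresh₁ : Fresh path₁ (suc t)
      fresh₁ = fresh-∷ a∉ τ∉ a≢τ (ℕₚ.<⇒≤ a<τ) ℕₚ.≤-refl fresh-suc

      fresh₂ : Fresh path₂ (suc t)
      fresh₂ = fresh-∷ τ∉ a∉ (a≢τ ∘ sym) ℕₚ.≤-refl (ℕₚ.<⇒≤ a<τ) fresh-suc

      fresh-spokes : ∀ ks → ks ⊆ K → Fresh (spokes τ ks ++ path₂) (suc t)
      fresh-spokes [] _ = fresh₂
      fresh-spokes (k ∷ ks) sub = let k∉ , k<t , _ = K⁻ (sub (here refl)) in
        fresh-∷ τ∉ k∉ (λ { refl → τ∉K (sub (here refl)) }) ℕₚ.≤-refl (ℕₚ.<⇒≤ k<t)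
          (fresh-spokes ks (sub ∘ there))

      fresh₃ : Fresh path₃ (suc t)
      fresh₃ = fresh-spokes K id

      Lowerτ Upperτ : Rel₂ n
      Lowerτ c d = (c ≡ τ × d ≡ a) ⊎ (c ∉ rem × (c , d) ∈ α × (c ≡ τ ⊎ suc t ≤ toℕ c))
      Upperτ = Upper a t ⊕ (τ , a)

      -- Under `τ` → `a`, the triangle `τ` → `a` → `k` → `τ` trades each edge `τ` → `k` for `a` →
      -- `k`, which turns S(τ, t + 1) into a statement about `a`.
      chainτ : ∀ {av₁} → av₀ ⊆ av₁ → (D₂ : Der F path₃ av₁ (Lower τ (suc t)) (Upper τ (suc t))) →
        Σ[ D₂′ ∈ Der F path₃ av₁ (Lower τ (suc t)) (Upperτ ⊕⋆ (τ , K)) ]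
          (tree D₂′ ≡ tree D₂) × Chain {path = path₂} D₂′ Lowerτ Upperτ (length K) 1
      chainτ {av₁} sub₁ D₂ = D₂′ , refl , chain K (filter⁺ K? (allFin⁺ n)) irrτ
        (record { hub = τ∉K
                ; fresh = λ k∈ → fresh-path (K⁻ k∈)
                ; ¬out = λ { k∈ (inj₁ (inj₁ (eq , _))) → a≢τ (sym eq)
                           ; k∈ (inj₁ (inj₂ e)) → ¬into st (proj₁ (K⁻ k∈)) e
                           ; k∈ (inj₂ (_ , eq)) → proj₂ (proj₂ (K⁻ k∈)) eq }
                ; ¬in = λ { k∈ (inj₁ (inj₁ (eq , _))) → proj₂ (proj₂ (K⁻ k∈)) eq
                          ; k∈ (inj₁ (inj₂ e)) → ¬into st τ∉ e
                          ; k∈ (inj₂ (eq , _)) → τ∉K (subst (_∈ K) eq k∈) } })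
        D₂′ (λ k∈ → let k∉ , k<t , _ = K⁻ k∈ in
               inj₁ (refl , k∉ , ℕₚ.m<n⇒m<1+n k<t , λ { refl → τ∉K k∈ }))
        covered tri
        where
        fresh-path : ∀ {k} → k ∉ rem × toℕ k < t × k ≢ a → var (τ , k) ∉ map var path₂
        fresh-path {k} (k∉ , k<t , k≢a) h with τ≢k
          where
          τ≢k : τ ≢ k
          τ≢k refl = ℕₚ.<-irrefl refl k<t
        fresh-path {k} (k∉ , k<t , k≢a) (here eq) | τ≢k with var-injective τ≢k (a≢τ ∘ sym) eq
        ... | inj₁ (_ , k≡a) = k≢a k≡a
        ... | inj₂ (_ , k≡τ) = τ≢k (sym k≡τ)
        fresh-path {k} (k∉ , k<t , k≢a) (there h) | τ≢k =
          roots fr k∉ τ∉ (τ≢k ∘ sym) ℕₚ.≤-refl (subst (_∈ map var path) (var-sym τ≢k) h)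
        irrτ : Irreflexive Upperτ
        irrτ (inj₁ h) = Upper-irr h
        irrτ (inj₂ (refl , refl)) = a≢τ ∘ sym
        classify : ∀ {c d} → Upper τ (suc t) c d → (Upperτ ⊕⋆ (τ , K)) c d
        classify (inj₂ e) = inj₁ (inj₁ (inj₂ e))
        classify {d = d} (inj₁ (refl , d∉ , d<1+t , d≢τ)) with d ≟ a
        ... | yes refl = inj₁ (inj₂ (refl , refl))
        ... | no d≢a = inj₂ (refl , ∈-filter⁺ K? (∈-allFin d)
                (d∉ , ℕₚ.≤∧≢⇒< (ℕₚ.≤-pred d<1+t) (d≢τ ∘ Finₚ.toℕ-injective) , d≢a))
        D₂′ : Der F path₃ av₁ (Lower τ (suc t)) (Upperτ ⊕⋆ (τ , K))
        D₂′ = relax id classify D₂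
        covered : ∀ {c d} → Lowerτ c d → Upperτ c d × Lower τ (suc t) c d
        covered (inj₁ (refl , refl)) = inj₂ (refl , refl) , inj₁ (refl , a∉ , ℕₚ.m<n⇒m<1+n a<τ , a≢τ)
        covered (inj₂ h@(_ , e , _)) = inj₁ (inj₂ e) , inj₂ h
        tri : TriangleDers path₂ av₁ Upperτ τ K 1
        tri {k} sub _ av⊆ with K⁻ (sub (here refl))
        ... | k∉ , k<t , k≢a with ready {τ} {a} {k}
                 (τ∉ , a∉ , (a≢τ ∘ sym , k≢a ∘ sym , λ { refl → τ∉K (sub (here refl)) }) , inj₁ k∉)
                 (av⊆ ∘ sub₁)
        ... | D , le = relax (λ { (refl , refl) → inj₂ (inj₂ (refl , refl)) })
            (λ { (inj₁ (inj₁ (refl , refl))) → inj₁ (inj₁ (inj₂ (refl , refl)))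
               ; (inj₁ (inj₂ (inj₁ (refl , refl)))) → inj₁ (inj₁ (inj₁ (inj₁ (refl , k∉ , k<t , k≢a))))
               ; (inj₁ (inj₂ (inj₂ (refl , refl)))) → inj₂ (refl , refl)
               ; (inj₂ h) → inj₁ (inj₁ (inj₁ (inj₂ h))) }) D , le

      join : (D₁ : Der F path₁ av (Lower a (suc t)) (Upper a (suc t))) →
        Der F path₂ (av ++ concls D₁) Lowerτ Upperτ → Der F path av (Lower a t) (Upper a t)
      join D₁ D₂ = resolve a≢τ Upper-irr
        (λ { (inj₁ (_ , _ , t<t , _)) → ℕₚ.<-irrefl refl t<t ; (inj₂ e) → ¬into st τ∉ e })
        (λ { (inj₁ (τ≡a , _)) → a≢τ (sym τ≡a) ; (inj₂ e) → ¬into st a∉ e })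
        (roots fr a∉ τ∉ a≢τ ℕₚ.≤-refl)
        (relax id classify D₁) D₂
        (inj₁ (refl , τ∉ , ℕₚ.≤-refl , a≢τ ∘ sym)) (inj₁ (refl , refl))
        (λ l → Lower⇒Upper l , covered l)
        where
        classify : ∀ {c d} → Upper a (suc t) c d → (Upper a t ⊕ (a , τ)) c d
        classify (inj₂ e) = inj₁ (inj₂ e)
        classify {d = d} (inj₁ (refl , d∉ , d<1+t , d≢a)) with d ≟ τ
        ... | yes refl = inj₂ (refl , refl)
        ... | no d≢τ = inj₁ (inj₁ (refl , d∉ , ℕₚ.≤∧≢⇒< (ℕₚ.≤-pred d<1+t) (d≢τ ∘ Finₚ.toℕ-injective) , d≢a))
        covered : ∀ {c d} → Lower a t c d → Lower a (suc t) c d ⊎ Lowerτ c d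
        covered (inj₁ (eq , d∉ , lt , d≢a)) = inj₁ (inj₁ (eq , d∉ , ℕₚ.m<n⇒m<1+n lt , d≢a))
        covered (inj₂ (c∉ , e , inj₁ eq)) = inj₁ (inj₂ (c∉ , e , inj₁ eq))
        -- Edges of `α` leaving `τ` are not in `Lower a (suc t)`; only the second premise supplies
        -- them.
        covered {c} (inj₂ (c∉ , e , inj₂ le)) with c ≟ τ
        ... | yes eq = inj₂ (inj₂ (c∉ , e , inj₁ eq))
        ... | no c≢τ = inj₁ (inj₂ (c∉ , e , inj₂ (ℕₚ.≤∧≢⇒< le (λ eq → c≢τ (sym (Finₚ.toℕ-injective eq))))))

      branch : (a , t) ∈ todo → (o₁ : Outcome a (suc t) path₁ av todo h) →
        Outcome τ (suc t) path₃ (av ++ concls (out o₁)) (todo′ o₁) h → Outcome a t path av todo (suc h)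
      branch ∈todo o₁ o₂ with chainτ (∈-++⁺ˡ ∘ av₀⊆) (out o₂)
      -- Relaxing bounds keeps the tree, so size and lemmas of the base are those of `out o₂`.
      ... | _ , refl , ch = finish (progress o₁) (progress o₂)
        where
        D : Der F path av (Lower a t) (Upper a t)
        D = join (out o₁) (result ch)
        sub : (av ++ concls (out o₁)) ++ concls (out o₂) ⊆ av ++ concls D
        sub C∈ with ∈-++⁻ (av ++ concls (out o₁)) C∈
        ... | inj₁ p = node-concls {C = label (tree D)} {var (a , τ)} (tree (out o₁)) (tree (result ch)) (∈-++⁺ˡ p)
        ... | inj₂ p = node-concls {av = av} {label (tree D)} {var (a , τ)} (tree (out o₁)) (tree (result ch))
                         (∈-++⁺ʳ (av ++ concls (out o₁)) (base-⊆ ch p))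
        shrink₁₂ : length (todo′ o₂) + (gain o₁ + gain o₂) ≤ length todo
        shrink₁₂ = begin
          length (todo′ o₂) + (gain o₁ + gain o₂)
            ≡⟨ cong (length (todo′ o₂) +_) (ℕₚ.+-comm (gain o₁) (gain o₂)) ⟩
          length (todo′ o₂) + (gain o₂ + gain o₁)
            ≡⟨ ℕₚ.+-assoc (length (todo′ o₂)) _ _ ⟨
          length (todo′ o₂) + gain o₂ + gain o₁
            ≤⟨ ℕₚ.+-monoˡ-≤ (gain o₁) (shrink o₂) ⟩
          length (todo′ o₁) + gain o₁
            ≤⟨ shrink o₁ ⟩
          length todo ∎
          where open ℕₚ.≤-Reasoning
        size-D : ∀ {d} → gain o₁ + gain o₂ ≤ d → 1 ≤ d → size (tree D) ≤ 1 + rate * (suc (suc h) * d)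
        size-D = combine-≤ {suc h} {gain o₁} {gain o₂} (bound o₁) (bound o₂) (size-≤ ch) (length-filter-Fin K?)
        deeper : 1 ≤ gain o₁ + gain o₂ → Outcome a t path av todo (suc h)
        deeper pos = outcome D (todo′ o₂) (learned-⊆ sub (learned′ o₂)) _ shrink₁₂ (size-D ℕₚ.≤-refl pos) (inj₂ pos)
        finish : (isLeaf (tree (out o₁)) ≡ true × todo′ o₁ ≡ todo) ⊎ 1 ≤ gain o₁ →
                 (isLeaf (tree (out o₂)) ≡ true × todo′ o₂ ≡ todo′ o₁) ⊎ 1 ≤ gain o₂ →
                 Outcome a t path av todo (suc h)
        finish (inj₂ pos) _ = deeper (ℕₚ.≤-trans pos (ℕₚ.m≤m+n _ _))
        finish (inj₁ _) (inj₂ pos) = deeper (ℕₚ.≤-trans pos (ℕₚ.m≤n+m _ _))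
        finish (inj₁ (leaf₁ , eq₁)) (inj₁ (leaf₂ , eq₂)) =
          outcome D _ (learnRoot D inp sub (learned′ o₂))
            (suc (gain o₁ + gain o₂)) shr (size-D (ℕₚ.n≤1+n _) (s≤s z≤n)) (inj₂ (s≤s z≤n))
          where
          -- A leaf is resolved with a chain that starts at a leaf and uses only leaf triangles.
          inp : isInput (tree D) ≡ true
          inp rewrite leaf₁ | leaf⇒input (tree (out o₁)) leaf₁
            = input ch ℕₚ.≤-refl (leaf⇒input (tree (out o₂)) leaf₂)
          shr : length (remove _≟ᵢ_ (a , t) (todo′ o₂)) + suc (gain o₁ + gain o₂) ≤ length todo
          shr = ℕₚ.≤-trans
            (ℕₚ.≤-trans (ℕₚ.≤-reflexive (ℕₚ.+-suc _ _))
              (ℕₚ.+-monoˡ-≤ _ (length-remove _≟ᵢ_ (subst ((a , t) ∈_) (sym (trans eq₂ eq₁)) ∈todo))))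
            shrink₁₂

    -- A depth-first traversal of the dag: `h` counts the levels left up to `n`, and a clause is
    -- expanded only while it is missing.
    derive : ∀ h t → t + h ≡ n → ∀ {a path av todo} → a ∉ rem → toℕ a < t → Fresh path t →
      av₀ ⊆ av → Learned av todo → Outcome a t path av todo h
    derive h t eq {a} {todo = todo} a∉ a<t fr av₀⊆ l with (a , t) ∈ⁱ? todo
    ... | no ∉todo = recall a∉ (ℕₚ.≤-trans (ℕₚ.m≤m+n t h) (ℕₚ.≤-reflexive eq)) l ∉todo
    derive zero t eq a∉ a<t fr av₀⊆ l | yes ∈todo
      with trans (sym (ℕₚ.+-identityʳ t)) eq
    ... | refl = bottom a∉ fr av₀⊆ l ∈todo
    derive (suc h) t eq {a} {path} {av} a∉ a<t fr av₀⊆ l | yes ∈todo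
      with fromℕ< t<n | Finₚ.toℕ-fromℕ< t<n
      where
      t<n : t < n
      t<n = ℕₚ.≤-trans (ℕₚ.m≤m+n (suc t) h) (ℕₚ.≤-reflexive (trans (sym (ℕₚ.+-suc t h)) eq))
    ... | τ | refl with τ ∈ᶠ? rem
    ... | yes τ∈ = skip τ τ∈ (derive h (suc (toℕ τ)) (trans (sym (ℕₚ.+-suc _ h)) eq) a∉
                     (ℕₚ.m<n⇒m<1+n a<t)
                     (record { roots = λ b∉ d∉ b≢d lt → roots fr b∉ d∉ b≢d (ℕₚ.<⇒≤ lt)
                             ; others = others fr }) av₀⊆ l)
    ... | no τ∉ = branch ∈todo o₁ o₂
      where
      open Branch {h = h} a∉ τ∉ a<t fr av₀⊆
      o₁ : Outcome a (suc (toℕ τ)) path₁ av _ h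
      o₁ = derive h (suc (toℕ τ)) (trans (sym (ℕₚ.+-suc _ h)) eq) a∉ (ℕₚ.m<n⇒m<1+n a<t) fresh₁ av₀⊆ l
      o₂ : Outcome τ (suc (toℕ τ)) path₃ (av ++ concls (out o₁)) (todo′ o₁) h
      o₂ = derive h (suc (toℕ τ)) (trans (sym (ℕₚ.+-suc _ h)) eq) τ∉ ℕₚ.≤-refl fresh₃
             (∈-++⁺ˡ ∘ av₀⊆) (learned′ o₁)

  -- Refuting a state in which all triangles are ready

  RootEdges : List (Edge n) → List (Fin n) → Rel₂ n
  RootEdges α rem a b = a ∉ rem × (a , b) ∈ α

  On : List (Edge n) → Rel₂ n
  On α a b = (a , b) ∈ α

  -- At most `n * suc n` dag clauses are learned, each charged `rate` at most once on each of at
  -- most `suc n` levels.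
  base-size : ℕ
  base-size = 1 + rate * (suc n * (n * suc n))

  firstRoot : ∀ (rem : List (Fin n)) → (∃ λ c → c ∉ rem) →
    ∃ λ a → a ∉ rem × (∀ {d} → d ∉ rem → toℕ a ≤ toℕ d)
  firstRoot rem (c , c∉)
    with Finₚ.¬∀⟶∃¬-smallest n (_∈ rem) (_∈ᶠ? rem) (λ h → c∉ (h c))
  ... | a , a∉ , below = a , a∉ , λ {d} d∉ → ℕₚ.≮⇒≥ (λ d<a → d∉ (subst (_∈ rem)
          (Finₚ.toℕ-injective (trans (Finₚ.toℕ-inject (fromℕ< d<a)) (Finₚ.toℕ-fromℕ< d<a)))
          (below (fromℕ< d<a))))

  refuteReady : ∀ {α rem av} → State α rem → (∃ λ c → c ∉ rem) → TriReady α rem av →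
    Σ[ D ∈ Der F α av (RootEdges α rem) (On α) ] size (tree D) ≤ base-size
  refuteReady {α} {rem} {av} st root ready with firstRoot rem root
  ... | a , a∉ , least =
      relax (λ { (c∉ , e) → inj₂ (c∉ , e , split c∉) })
            -- No root other than `a` lies below level `a` + 1, so only edges of `α` remain.
            (λ { (inj₂ e) → e ; (inj₁ (_ , d∉ , d<1+a , d≢a)) →
                 ⊥-elim (d≢a (Finₚ.toℕ-injective (ℕₚ.≤-antisym (ℕₚ.≤-pred d<1+a) (least d∉)))) })
            (out o)
    , ℕₚ.≤-trans (bound o) (s≤s (ℕₚ.*-monoʳ-≤ rate (ℕₚ.*-mono-≤ (s≤s (ℕₚ.m∸n≤m n (suc (toℕ a)))) gain≤)))
    where
    open Inner st ready
    open Outcome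
    todo : List LemmaIndex
    todo = cartesianProduct (allFin n) (upTo (suc n))
    split : ∀ {c} → c ∉ rem → (c ≡ a) ⊎ (suc (toℕ a) ≤ toℕ c)
    split {c} c∉ with c ≟ a
    ... | yes eq = inj₁ eq
    ... | no c≢a = inj₂ (ℕₚ.≤∧≢⇒< (least c∉) (λ eq → c≢a (sym (Finₚ.toℕ-injective eq))))
    fresh₀ : Fresh α (suc (toℕ a))
    fresh₀ = record { roots = λ b∉ d∉ b≢d _ → var∉ b≢d (irr st) (¬into st d∉) (¬into st b∉)
                    ; others = λ { b∉ k∈ ¬e → var∉ (λ { refl → b∉ k∈ }) (irr st) ¬e (¬into st b∉) } }
    o : Outcome a (suc (toℕ a)) α av todo (n ∸ suc (toℕ a))
    o = derive _ _ (ℕₚ.m+[n∸m]≡n (Finₚ.toℕ<n a)) a∉ ℕₚ.≤-refl fresh₀ id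
          (λ {b} _ t≤n ∉todo → ⊥-elim (∉todo (∈-cartesianProduct⁺ (∈-allFin b) (∈-upTo⁺ (s≤s t≤n)))))
    gain≤ : gain o ≤ n * suc n
    gain≤ = ℕₚ.≤-trans (ℕₚ.m≤n+m _ _) (ℕₚ.≤-trans (shrink o) (ℕₚ.≤-reflexive
      (trans (length-cartesianProduct (allFin n) (upTo (suc n)))
        (cong₂ _*_ (Listₚ.length-tabulate {n = n} id) (Listₚ.length-upTo (suc n))))))

  -- Bookkeeping for learned triangles

  Triple : Set
  Triple = Fin n × Fin n × Fin n

  _≟ᵗ_ : DecidableEquality Triple
  _≟ᵗ_ = ≡-dec _≟_ (≡-dec _≟_ _≟_)

  open DecMembership _≟ᵗ_ using () renaming (_∈?_ to _∈ᵗ?_)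

  TriLearned : List (Clause (Var n)) → List Triple → Set
  TriLearned av todo = ∀ {i j k} → Distinct3 i j k → (i , j , k) ∉ todo → Available av (Tri i j k) (Tri i j k)

  triLearned-⊆ : ∀ {av av′ todo} → av ⊆ av′ → TriLearned av todo → TriLearned av′ todo
  triLearned-⊆ sub l dist ∉todo = let C , C∈ , b = l dist ∉todo in C , sub C∈ , b

  -- price bounds what learning one triangle adds to the size: three settled
  -- calls and six further nodes, less one base-size.
  settled-size price : ℕ
  settled-size = base-size + n * 4
  price = 2 * base-size + (n * 12 + 6)

  -- `slack` is the part of the size not charged to learned triangles; it adds up over inferences.
  record Result (α : List (Edge n)) (av : List (Clause (Var n))) (todo : List Triple)
                (L : Rel₂ n) (slack : ℕ) : Set where
    constructor mkResult
    field
      der′    : Der F α av L (On α)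
      todo′   : List Triple
      learned : TriLearned (av ++ concls der′) todo′
      gain    : ℕ
      shrink  : length todo′ + gain ≤ length todo
      bound   : size (tree der′) ≤ slack + price * gain

  open Result

  -- The two branches run in sequence: the second starts from the triangles learned in the first.
  resolveR : ∀ {α av todo L₁ L₂ L S₁ S₂ a b} → a ≢ b → Irreflexive (On α) →
    (a , b) ∉ α → (b , a) ∉ α →
    (R₁ : Result ((a , b) ∷ α) av todo L₁ S₁) →
    (R₂ : Result ((b , a) ∷ α) (av ++ concls (der′ R₁)) (todo′ R₁) L₂ S₂) →
    L₁ a b → L₂ b a → (∀ {c d} → L c d → On α c d × (L₁ c d ⊎ L₂ c d)) →
    Result α av todo L (suc (S₁ + S₂))
  resolveR {α} {av} {todo} {L} {S₁ = S₁} {S₂ = S₂} {a} {b} a≢b irrα ab∉ ba∉ R₁ R₂ l₁ l₂ L⇒ = mkResult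
    (resolve a≢b irrα ab∉ ba∉ (var∉ a≢b irrα ab∉ ba∉) (relax id split (der′ R₁)) (relax id split (der′ R₂)) l₁ l₂ L⇒)
    (todo′ R₂)
    (triLearned-⊆ (node-concls {C = _} {var (a , b)} (tree (der′ R₁)) (tree (der′ R₂))) (learned R₂))
    (gain R₂ + gain R₁) shr bnd
    where
    open ℕₚ.≤-Reasoning
    split : ∀ {e c d} → (c , d) ∈ e ∷ α → (On α ⊕ e) c d
    split (here refl) = inj₂ (refl , refl)
    split (there h) = inj₁ h
    shr : length (todo′ R₂) + (gain R₂ + gain R₁) ≤ length todo
    shr = begin
      length (todo′ R₂) + (gain R₂ + gain R₁) ≡⟨ ℕₚ.+-assoc (length (todo′ R₂)) _ _ ⟨
      length (todo′ R₂) + gain R₂ + gain R₁   ≤⟨ ℕₚ.+-monoˡ-≤ (gain R₁) (shrink R₂) ⟩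
      length (todo′ R₁) + gain R₁             ≤⟨ shrink R₁ ⟩
      length todo                             ∎
    rearrange : ∀ S₁ S₂ p g₁ g₂ → suc ((S₁ + p * g₁) + (S₂ + p * g₂)) ≡ suc (S₁ + S₂) + p * (g₂ + g₁)
    rearrange = solve-∀
    bnd : suc (size (tree (der′ R₁)) + size (tree (der′ R₂))) ≤ suc (S₁ + S₂) + price * (gain R₂ + gain R₁)
    bnd = begin
      suc (size (tree (der′ R₁)) + size (tree (der′ R₂)))
        ≤⟨ s≤s (ℕₚ.+-mono-≤ (bound R₁) (bound R₂)) ⟩
      suc ((S₁ + price * gain R₁) + (S₂ + price * gain R₂))
        ≡⟨ rearrange S₁ S₂ price (gain R₁) (gain R₂) ⟩
      suc (S₁ + S₂) + price * (gain R₂ + gain R₁) ∎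

  Solver : ℕ → Set
  Solver N = ∀ {α rem av todo} → State α rem → (∃ λ c → c ∉ rem) → length todo < N →
    TriLearned av todo → Result α av todo (RootEdges α rem) base-size

  -- Queries the edges c → k needed for every non-root k to be dominated by a
  -- root, when k is known to be reachable from c in two steps.
  settle : ∀ {N α rem av todo c} → Solver N → c ∉ rem → Irreflexive (On α) →
    (∀ {a b} → b ∉ rem → (a , b) ∉ α) →
    (∀ {k} → k ∈ rem → (∃ λ d → d ∉ rem × (d , k) ∈ α) ⊎ (∃ λ e → (c , e) ∈ α × (e , k) ∈ α)) →
    length todo < N → TriLearned av todo → Result α av todo (RootEdges α rem) settled-size
  settle {α = α} {rem} {av} {todo} {c} solver c∉ irrα ¬intoα par lt l = mkResult
    (result ch) (todo′ R) (triLearned-⊆ sub (learned R)) (gain R) (shrink R) bnd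
    where
    Via : Fin n → Set
    Via k = ∃ λ e → (c , e) ∈ α × (e , k) ∈ α
    K? : ∀ k → Dec (k ∈ rem × (c , k) ∉ α × Via k)
    K? k = (k ∈ᶠ? rem) ×-dec (¬? ((c , k) ∈ᵉ? α) ×-dec
             Finₚ.any? (λ e → ((c , e) ∈ᵉ? α) ×-dec ((e , k) ∈ᵉ? α)))
    K : List (Fin n)
    K = filter K? (allFin n)
    K⁻ : ∀ {k} → k ∈ K → k ∈ rem × (c , k) ∉ α × Via k
    K⁻ h = proj₂ (∈-filter⁻ K? {xs = allFin n} h)
    c∉K : c ∉ K
    c∉K h = c∉ (proj₁ (K⁻ h))
    α⁺ : List (Edge n)
    α⁺ = spokes c K ++ α
    old : ∀ {a b} ks → (a , b) ∈ spokes c ks ++ α → (On α ⊕⋆ (c , ks)) a b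
    old ks h with ∈-++⁻ (spokes c ks) h
    ... | inj₂ h′ = inj₁ h′
    ... | inj₁ h′ with ∈-map⁻ (c ,_) h′
    ... | k , k∈ , refl = inj₂ (refl , k∈)
    irr-spokes : ∀ ks → ks ⊆ K → Irreflexive (On (spokes c ks ++ α))
    irr-spokes ks sub h with old ks h
    ... | inj₁ h′ = irrα h′
    ... | inj₂ (refl , k∈) = λ { refl → c∉K (sub k∈) }
    st⁺ : State α⁺ rem
    st⁺ = record { irr = irr-spokes K id ; ¬into = ¬into⁺ ; parent = parent⁺ }
      where
      ¬into⁺ : ∀ {a b} → b ∉ rem → (a , b) ∉ α⁺
      ¬into⁺ b∉ h with old K h
      ... | inj₁ h′ = ¬intoα b∉ h′
      ... | inj₂ (_ , b∈) = b∉ (proj₁ (K⁻ b∈))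
      parent⁺ : ∀ {k} → k ∈ rem → ∃ λ d → d ∉ rem × (d , k) ∈ α⁺
      parent⁺ {k} k∈ with par k∈ | (c , k) ∈ᵉ? α
      ... | inj₁ (d , d∉ , e) | _ = d , d∉ , ∈-++⁺ʳ (spokes c K) e
      ... | inj₂ _ | yes e = c , c∉ , ∈-++⁺ʳ (spokes c K) e
      ... | inj₂ via | no ¬e = c , c∉ , ∈-++⁺ˡ (∈-map⁺ (c ,_) (∈-filter⁺ K? (∈-allFin k) (k∈ , ¬e , via)))
    R : Result α⁺ av todo (RootEdges α⁺ rem) base-size
    R = solver st⁺ (c , c∉) lt l
    base : Der F (spokes c K ++ α) av (RootEdges α⁺ rem) (On α ⊕⋆ (c , K))
    base = relax id (old K) (der′ R)
    -- These triangles may still need an inference on their guard, hence size 3 and, with the chain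
    -- node, 4 per edge.
    tri : TriangleDers α av (On α) c K 3
    tri {k} {ks′} sub k∉ _ with K⁻ (sub (here refl))
    ... | k∈ , ¬e , e , ce , ek
          with triangleAny {c} {e} {k} (irrα ce , irrα ek , λ { refl → c∉ k∈ })
            {(k , c) ∷ spokes c ks′ ++ α}
            (λ { (here refl) → λ { refl → c∉ k∈ } ; (there h) → irr-spokes ks′ (sub ∘ there) h })
    ... | D , le = relax (λ { (refl , refl) → inj₂ (inj₂ (refl , refl)) })
        (λ { (inj₁ (inj₁ (refl , refl))) → inj₁ (inj₁ ce)
           ; (inj₁ (inj₂ (inj₁ (refl , refl)))) → inj₁ (inj₁ ek)
           ; (inj₁ (inj₂ (inj₂ (refl , refl)))) → inj₂ (refl , refl)
           ; (inj₂ (here refl)) → inj₂ (refl , refl)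
           ; (inj₂ (there h)) → inj₁ (old ks′ h) }) D , le
    ch : Chain {path = α} base (RootEdges α rem) (On α) (length K) 3
    ch = chain K (filter⁺ K? (allFin⁺ n)) irrα
      (record { hub = c∉K
              ; fresh = λ { h → let k∈ , ¬e , _ = K⁻ h in var∉ (λ { refl → c∉ k∈ }) irrα ¬e (¬intoα c∉) }
              ; ¬out = λ h → proj₁ (proj₂ (K⁻ h)) ; ¬in = λ _ → ¬intoα c∉ })
      base (λ h → c∉ , ∈-++⁺ˡ (∈-map⁺ (c ,_) h))
      (λ { (a∉ , e) → e , a∉ , ∈-++⁺ʳ (spokes c K) e }) tri
    sub : av ++ concls (der′ R) ⊆ av ++ concls (result ch)
    sub = Subset.++⁺ʳ av (base-⊆ ch)
    open ℕₚ.≤-Reasoning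
    rearrange : ∀ a b c → (a + b) + c ≡ (a + c) + b
    rearrange = solve-∀
    bnd : size (tree (result ch)) ≤ settled-size + price * gain R
    bnd = begin
      size (tree (result ch))               ≤⟨ size-≤ ch ⟩
      size (tree (der′ R)) + length K * 4   ≤⟨ ℕₚ.+-mono-≤ (bound R) (ℕₚ.*-monoˡ-≤ 4 (length-filter-Fin K?)) ⟩
      (base-size + price * gain R) + n * 4  ≡⟨ rearrange base-size (price * gain R) (n * 4) ⟩
      settled-size + price * gain R         ∎

  -- Branching on the edges of a triangle

  irr-∷ : ∀ {β : List (Edge n)} {a b} → a ≢ b → Irreflexive (On β) → Irreflexive (On ((a , b) ∷ β))
  irr-∷ a≢b irrβ (here refl) = a≢b
  irr-∷ _ irrβ (there h) = irrβ h

  -- A guard is never an edge of its own triangle, so branching on the triangle leaves it free to be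
  -- resolved on.
  guard∉-∷ : ∀ {β i j k a b} → Distinct3 i j k → Tri i j k a b → var (guard i j k) ∉ map var β →
    var (guard i j k) ∉ map var ((a , b) ∷ β)
  guard∉-∷ _ _ g∉ (there h) = g∉ h
  guard∉-∷ {a = a} {b} dist t g∉ (here eq)
    with var-injective {c = a} {b} (r≢s dist) (Tri-irr dist t) eq
  ... | inj₁ (p , q) = proj₁ (guard∉Tri dist t) (cong₂ _,_ p q)
  ... | inj₂ (p , q) = proj₂ (guard∉Tri dist t) (cong₂ _,_ q p)

  -- With `p` → `q` asserted, a vertex whose parent was `q` is reached from `p` in two steps, which
  -- is what `settle` repairs.
  dropRoot : ∀ {N α rem av todo p q} → Solver N → p ∉ rem → p ≢ q → Irreflexive (On α) →
    (∀ {a b} → b ∉ rem → (a , b) ∉ α) →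
    (∀ {k} → k ∈ rem → (∃ λ d → d ∉ rem × (d , k) ∈ α) ⊎ (∃ λ e → (p , e) ∈ α × (e , k) ∈ α)) →
    length todo < N → TriLearned av todo →
    Result ((p , q) ∷ α) av todo (RootEdges ((p , q) ∷ α) (q ∷ rem)) settled-size
  dropRoot {α = α} {rem} {p = p} {q} solver p∉ p≢q irrα ¬intoα par =
    settle solver p∉′ (irr-∷ p≢q irrα)
      (λ { b∉ (here refl) → b∉ (here refl) ; b∉ (there h) → ¬intoα (b∉ ∘ there) h }) par′
    where
    p∉′ : p ∉ q ∷ rem
    p∉′ (here eq) = p≢q eq
    p∉′ (there h) = p∉ h
    par′ : ∀ {k} → k ∈ q ∷ rem → (∃ λ d → d ∉ q ∷ rem × (d , k) ∈ (p , q) ∷ α) ⊎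
                                  (∃ λ e → (p , e) ∈ (p , q) ∷ α × (e , k) ∈ (p , q) ∷ α)
    par′ (here refl) = inj₁ (p , p∉′ , here refl)
    par′ (there k∈) with par k∈
    ... | inj₂ (e , pe , ek) = inj₂ (e , there pe , there ek)
    ... | inj₁ (d , d∉ , dk) with d ≟ q
    ... | yes refl = inj₂ (q , here refl , there dk)
    ... | no d≢q = inj₁ (d , (λ { (here eq) → d≢q eq ; (there h) → d∉ h }) , there dk)

  -- The branching for a non-root `k`: `j` → `i` drops the root `i`; under `i` → `j`, either `k` →
  -- `i` closes the cycle or `i` → `k` drops `j`. `par` also accepts vertices below `k`, as `k` may
  -- itself have just stopped being a root.
  module Learn {N : ℕ} (solver : Solver N) {α rem av todo} {i j k : Fin n}
    (irrα : Irreflexive (On α)) (¬intoα : ∀ {a b} → b ∉ rem → (a , b) ∉ α)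
    (par : ∀ {l} → l ∈ rem → (∃ λ d → d ∉ rem × (d , l) ∈ α) ⊎ (k , l) ∈ α)
    (i∉ : i ∉ rem) (j∉ : j ∉ rem) (k∈ : k ∈ rem) (dist : Distinct3 i j k)
    (jk : (j , k) ∈ α) (¬ik : (i , k) ∉ α) (guard∉ : var (guard i j k) ∉ map var α)
    (lt : length (remove _≟ᵗ_ (i , j , k) todo) < N) (l : TriLearned av todo) where

    private
      i≢j : i ≢ j
      i≢j = proj₁ dist
      j≢k : j ≢ k
      j≢k = proj₁ (proj₂ dist)
      k≢i : k ≢ i
      k≢i = proj₂ (proj₂ dist)

    todo₁ : List Triple
    todo₁ = remove _≟ᵗ_ (i , j , k) todo

    αᵢⱼ αⱼᵢ αₖᵢ αᵢₖ : List (Edge n)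
    αᵢⱼ = (i , j) ∷ α
    αⱼᵢ = (j , i) ∷ α
    αₖᵢ = (k , i) ∷ αᵢⱼ
    αᵢₖ = (i , k) ∷ αᵢⱼ

    irrᵢⱼ : Irreflexive (On αᵢⱼ)
    irrᵢⱼ = irr-∷ i≢j irrα

    newLemma : Result αₖᵢ av todo₁ (Tri i j k) 3
    -- The triple is already absent from `todo₁`, so no gain is counted here; the slack 3 pays for
    -- the guard inference.
    newLemma = mkResult D todo₁ learned₁ 0 (ℕₚ.≤-reflexive (ℕₚ.+-identityʳ _)) (ℕₚ.m≤m+n 3 _)
      where
      T : Der F αₖᵢ av (Tri i j k) (Tri i j k)
      T = triangle dist (guard∉-∷ {αᵢⱼ} dist (inj₂ (inj₂ (refl , refl)))
        (guard∉-∷ {α} dist (inj₁ (refl , refl)) guard∉))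
      D : Der F αₖᵢ av (Tri i j k) (On αₖᵢ)
      D = relax id (λ { (inj₁ (refl , refl)) → there (here refl)
                      ; (inj₂ (inj₁ (refl , refl))) → there (there jk)
                      ; (inj₂ (inj₂ (refl , refl))) → here refl }) T
      learned₁ : TriLearned (av ++ concls D) todo₁
      learned₁ {i′} {j′} {k′} dist′ ∉todo₁ with ∉-remove _≟ᵗ_ {i , j , k} {i′ , j′ , k′} {todo} ∉todo₁
      ... | inj₁ refl = label (tree T) , ∈-++⁺ʳ av (root-∈-inputConcls (tree T) refl) , bounds T
      ... | inj₂ ∉todo = triLearned-⊆ {todo = todo} ∈-++⁺ˡ l dist′ ∉todo

    below : ∀ {β av′ L S} (R : Result β av′ todo₁ L S) → length (todo′ R) < N
    below R = ℕₚ.≤-trans (s≤s (ℕₚ.≤-trans (ℕₚ.m≤m+n _ _) (shrink R))) lt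

    drop-j : Result αᵢₖ (av ++ concls (der′ newLemma)) todo₁ (RootEdges αᵢₖ (j ∷ rem)) settled-size
    drop-j = settle {c = i} solver (λ { (here eq) → i≢j eq ; (there h) → i∉ h })
      (irr-∷ (k≢i ∘ sym) irrᵢⱼ)
      (λ { b∉ (here refl) → b∉ (there k∈) ; b∉ (there (here refl)) → b∉ (here refl)
         ; b∉ (there (there h)) → ¬intoα (b∉ ∘ there) h })
      par′ lt (learned newLemma)
      where
      par′ : ∀ {m} → m ∈ j ∷ rem → (∃ λ d → d ∉ j ∷ rem × (d , m) ∈ αᵢₖ) ⊎ (∃ λ e → (i , e) ∈ αᵢₖ × (e , m) ∈ αᵢₖ)
      par′ (here refl) = inj₁ (i , (λ { (here eq) → i≢j eq ; (there h) → i∉ h }) , there (here refl))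
      par′ (there m∈) with par m∈
      ... | inj₂ km = inj₂ (k , here refl , there (there km))
      ... | inj₁ (d , d∉ , dm) with d ≟ j
      ... | yes refl = inj₂ (j , there (here refl) , there (there dm))
      ... | no d≢j = inj₁ (d , (λ { (here eq) → d≢j eq ; (there h) → d∉ h }) , there (there dm))

    drop-i : ∀ {av′ todo′} → length todo′ < N → TriLearned av′ todo′ →
      Result αⱼᵢ av′ todo′ (RootEdges αⱼᵢ (i ∷ rem)) settled-size
    drop-i = dropRoot solver j∉ (i≢j ∘ sym) irrα ¬intoα
      (λ m∈ → [ inj₁ , (λ km → inj₂ (k , jk , km)) ]′ (par m∈))

    LowerR : Rel₂ n
    LowerR a b = On αᵢⱼ a b × (Tri i j k a b ⊎ RootEdges αᵢₖ (j ∷ rem) a b)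

    ifᵢⱼ : Result αᵢⱼ av todo₁ LowerR (suc (3 + settled-size))
    ifᵢⱼ = resolveR k≢i irrᵢⱼ
      (λ { (here eq) → k≢i (cong proj₁ eq) ; (there h) → ¬intoα i∉ h })
      (λ { (here eq) → j≢k (sym (cong proj₂ eq)) ; (there h) → ¬ik h })
      -- The cycle comes first in postorder, so its clause is a lemma for all other branches.
      newLemma drop-j (inj₂ (inj₂ (refl , refl)))
      ((λ { (here eq) → i≢j eq ; (there h) → i∉ h }) , here refl)
      id

    learn : Result α av todo₁ (RootEdges α rem) (suc (suc (3 + settled-size) + settled-size))
    learn = resolveR i≢j irrα (¬intoα j∉) (¬intoα i∉) ifᵢⱼ (drop-i (below ifᵢⱼ) (learned ifᵢⱼ))
      (here refl , inj₁ (inj₁ (refl , refl)))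
      ((λ { (here eq) → i≢j (sym eq) ; (there h) → j∉ h }) , here refl)
      (λ { (a∉ , e) → e , covered a∉ e })
      where
      -- Edges leaving `j` are covered by the branch where `j` is still a root, all others by the
      -- branch that drops `j`.
      covered : ∀ {a b} → a ∉ rem → (a , b) ∈ α → LowerR a b ⊎ RootEdges αⱼᵢ (i ∷ rem) a b
      covered {a} a∉ e with a ≟ j
      ... | yes refl = inj₂ ((λ { (here eq) → i≢j (sym eq) ; (there h) → a∉ h }) , there e)
      ... | no a≢j = inj₁ (there e , inj₂ ((λ { (here eq) → a≢j eq ; (there h) → a∉ h }) , there (there e)))

  open Learn using (learn)

  widen : ∀ {α av todo L S S′} → S ≤ S′ → Result α av todo L S → Result α av todo L S′
  widen S≤ (mkResult D todo l g sh b) = mkResult D todo l g sh (ℕₚ.≤-trans b (ℕₚ.+-monoˡ-≤ _ S≤))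

  -- If `k` is a root, a branch on `j` and `k` comes first: `j` → `k` makes `k` a non-root as
  -- `Learn` expects, and `k` → `j` drops `j`.
  learn-step : ∀ {N α rem av todo i j k} → Solver N → State α rem → Needed α rem i j k →
    var (guard i j k) ∉ map var α → length (remove _≟ᵗ_ (i , j , k) todo) < N → TriLearned av todo →
    Result α av (remove _≟ᵗ_ (i , j , k) todo) (RootEdges α rem) (base-size + price)
  learn-step {rem = rem} solver st (i∉ , j∉ , dist , inj₂ (jk , ¬ik)) guard∉ lt l =
    -- One branching fewer than in the other case; `suc settled-size` pads the cost to the common
    -- price.
    widen (ℕₚ.≤-trans (ℕₚ.m≤m+n _ (suc settled-size)) (ℕₚ.≤-reflexive (cost base-size n)))
      (learn solver (irr st) (¬into st) (inj₁ ∘ parent st) i∉ j∉ k∈ dist jk ¬ik guard∉ lt l)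
    where
    k∈ : _ ∈ rem
    k∈ with _ ∈ᶠ? rem
    ... | yes h = h
    ... | no h = ⊥-elim (¬into st h jk)
    cost : ∀ b m → suc (suc (3 + (b + m * 4)) + (b + m * 4)) + suc (b + m * 4) ≡ b + (2 * b + (m * 12 + 6))
    cost = solve-∀
  learn-step {N} {α} {rem} {av} {todo} {i} {j} {k} solver st
      (i∉ , j∉ , dist@(i≢j , j≢k , k≢i) , inj₁ k∉) guard∉ lt l =
    widen (ℕₚ.≤-reflexive (cost base-size n))
      (resolveR j≢k (irr st) (¬into st k∉) (¬into st j∉) R₁ R₂
        (j∉′ , here refl) (k∉′ , here refl) (λ { (a∉ , e) → e , covered a∉ e }))
    where
    j∉′ : j ∉ k ∷ rem
    j∉′ (here eq) = j≢k eq
    j∉′ (there h) = j∉ h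
    k∉′ : k ∉ j ∷ rem
    k∉′ (here eq) = j≢k (sym eq)
    k∉′ (there h) = k∉ h
    par : ∀ {m} → m ∈ k ∷ rem → (∃ λ d → d ∉ k ∷ rem × (d , m) ∈ (j , k) ∷ α) ⊎ (k , m) ∈ (j , k) ∷ α
    par (here refl) = inj₁ (j , j∉′ , here refl)
    par (there m∈) with parent st m∈
    ... | d , d∉ , dm with d ≟ k
    ... | yes refl = inj₂ (there dm)
    ... | no d≢k = inj₁ (d , (λ { (here eq) → d≢k eq ; (there h) → d∉ h }) , there dm)
    R₁ : Result ((j , k) ∷ α) av (remove _≟ᵗ_ (i , j , k) todo) (RootEdges ((j , k) ∷ α) (k ∷ rem)) _
    R₁ = learn solver (irr-∷ j≢k (irr st))
      (λ { b∉ (here refl) → b∉ (here refl) ; b∉ (there h) → ¬into st (b∉ ∘ there) h }) par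
      (λ { (here eq) → k≢i (sym eq) ; (there h) → i∉ h }) j∉′ (here refl) dist (here refl)
      (λ { (here eq) → i≢j (cong proj₁ eq) ; (there h) → ¬into st k∉ h })
      (guard∉-∷ {α} dist (inj₂ (inj₁ (refl , refl))) guard∉) lt l
    R₂ : Result ((k , j) ∷ α) _ (todo′ R₁) (RootEdges ((k , j) ∷ α) (j ∷ rem)) settled-size
    R₂ = dropRoot solver k∉ (j≢k ∘ sym) (irr st) (¬into st) (inj₁ ∘ parent st)
      (ℕₚ.≤-trans (s≤s (ℕₚ.≤-trans (ℕₚ.m≤m+n _ _) (shrink R₁))) lt) (learned R₁)
    covered : ∀ {a b} → a ∉ rem → (a , b) ∈ α →
      RootEdges ((j , k) ∷ α) (k ∷ rem) a b ⊎ RootEdges ((k , j) ∷ α) (j ∷ rem) a b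
    covered {a} a∉ e with a ≟ k
    ... | yes refl = inj₂ (k∉′ , there e)
    ... | no a≢k = inj₁ ((λ { (here eq) → a≢k eq ; (there h) → a∉ h }) , there e)
    cost : ∀ b m → suc (suc (suc (3 + (b + m * 4)) + (b + m * 4)) + (b + m * 4)) ≡ b + (2 * b + (m * 12 + 6))
    cost = solve-∀

  -- The complete search and its polynomial bound

  Blocking : List (Edge n) → List (Fin n) → Triple → Set
  Blocking α rem (i , j , k) = Needed α rem i j k × var (guard i j k) ∉ map var α

  blocking? : ∀ α rem t → Dec (Blocking α rem t)
  blocking? α rem (i , j , k) =
    (¬? (i ∈ᶠ? rem) ×-dec (¬? (j ∈ᶠ? rem) ×-dec
      ((¬? (i ≟ j) ×-dec (¬? (j ≟ k) ×-dec ¬? (k ≟ i))) ×-dec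
       (¬? (k ∈ᶠ? rem) ⊎-dec (((j , k) ∈ᵉ? α) ×-dec ¬? ((i , k) ∈ᵉ? α))))))
    ×-dec ¬? (var (guard i j k) ∈ᵉ? map var α)

  solve : ∀ N → Solver N
  solve (suc N) {α} {rem} {av} {todo} st root lt l with any? (blocking? α rem) todo
  ... | yes some with find some
  ... | (i , j , k) , ∈todo , needed , guard∉ = record
    { der′ = der′ R ; todo′ = todo′ R ; learned = learned R ; gain = suc (gain R)
    ; shrink = ℕₚ.≤-trans (ℕₚ.≤-reflexive (ℕₚ.+-suc _ _)) (ℕₚ.≤-trans (s≤s (shrink R)) fewer)
    ; bound = ℕₚ.≤-trans (bound R) (ℕₚ.≤-reflexive (rearrange base-size price (gain R))) }
    where
    fewer : length (remove _≟ᵗ_ (i , j , k) todo) < length todo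
    fewer = length-remove _≟ᵗ_ ∈todo
    R : Result α av (remove _≟ᵗ_ (i , j , k) todo) (RootEdges α rem) (base-size + price)
    R = learn-step (solve N) st needed guard∉ (ℕₚ.≤-trans fewer (ℕₚ.≤-pred lt)) l
    rearrange : ∀ b p g → (b + p) + p * g ≡ b + p * suc g
    rearrange = solve-∀
  solve (suc N) {α} {rem} {av} {todo} st root lt l | no none with refuteReady st root ready
    where
    ready : TriReady α rem av
    ready {i} {j} {k} needed av⊆ with (i , j , k) ∈ᵗ? todo
    ... | no ∉todo = let C , C∈ , b = l (proj₁ (proj₂ (proj₂ needed))) ∉todo in
            relax id inj₁ (lemmaLeaf (C , av⊆ C∈ , b)) , ℕₚ.≤-refl
    ... | yes ∈todo with guardOn? (proj₁ (proj₂ (proj₂ needed))) (irr st)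
    ... | inj₁ on = triangleOn (proj₁ (proj₂ (proj₂ needed))) on
    ... | inj₂ guard∉ = ⊥-elim (none (lose ∈todo (needed , guard∉)))
  ... | D , le = mkResult D todo (triLearned-⊆ ∈-++⁺ˡ l) 0 (ℕₚ.≤-reflexive (ℕₚ.+-identityʳ _))
                   (ℕₚ.≤-trans le (ℕₚ.m≤m+n _ _))

  -- Initially every vertex is a root and no edge is asserted, so the upper bound leaves only the
  -- empty clause.
  refutation : Fin n →
    Σ[ T ∈ Tree (Var n) ] (RegRTIRefutation F T × size T ≤ base-size + price * (n * (n * n)))
  refutation c = tree D , (valid D , empty) ,
    ℕₚ.≤-trans (bound R) (ℕₚ.+-monoʳ-≤ base-size (ℕₚ.*-monoʳ-≤ price
      (ℕₚ.≤-trans (ℕₚ.m≤n+m _ _) (ℕₚ.≤-trans (shrink R) (ℕₚ.≤-reflexive count)))))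
    where
    triples : List Triple
    triples = cartesianProduct (allFin n) (cartesianProduct (allFin n) (allFin n))
    count : length triples ≡ n * (n * n)
    count = trans (length-cartesianProduct (allFin n) (cartesianProduct (allFin n) (allFin n)))
      (cong₂ _*_ length-allFin (trans (length-cartesianProduct (allFin n) (allFin n))
        (cong₂ _*_ length-allFin length-allFin)))
      where
      length-allFin : length (allFin n) ≡ n
      length-allFin = Listₚ.length-tabulate id
    R : Result [] [] triples (RootEdges [] []) base-size
    R = solve (suc (length triples))
      (record { irr = λ () ; ¬into = λ _ () ; parent = λ () }) (c , λ ()) ℕₚ.≤-refl
      (λ {i} {j} {k} _ ∉all → ⊥-elim (∉all (∈-cartesianProduct⁺ (∈-allFin i)
        (∈-cartesianProduct⁺ (∈-allFin j) (∈-allFin k)))))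
    D : Der F [] [] (RootEdges [] []) (On [])
    D = der′ R
    empty : label (tree D) ≐ []
    empty l = mk⇔ (λ l∈ → contradiction (proj₁ (proj₂ (proj₂ (proj₂ (upper D l∈))))) λ ()) (λ ())

theorem2 : Σ[ p ∈ List ℕ ] (∀ (n : ℕ) → 2 ≤ n →
    (r s : Fin n → Fin n → Fin n → Fin n) → Guards r s →
    Σ[ T ∈ Tree (Var n) ] (RegRTIRefutation (GGT r s) T × size T ≤ evalPoly p n))
-- The expansion of `base-size + price * (n * (n * n))`, constant term first.
theorem2 = (1 ∷ 2 ∷ 6 ∷ 14 ∷ 18 ∷ 12 ∷ 12 ∷ 4 ∷ []) , λ n 2≤n r s guards →
  let T , refutes , size≤ = GuardedTautology.refutation guards (fromℕ< (ℕₚ.≤-trans (s≤s z≤n) 2≤n))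
  in T , refutes , ℕₚ.≤-trans size≤ (ℕₚ.≤-reflexive (total n))
  where
  total : ∀ m → 1 + (2 + m * 2) * (suc m * (m * suc m)) +
                (2 * (1 + (2 + m * 2) * (suc m * (m * suc m))) + (m * 12 + 6)) * (m * (m * m)) ≡
                1 + m * (2 + m * (6 + m * (14 + m * (18 + m * (12 + m * (12 + m * (4 + m * 0)))))))
  total = solve-∀
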